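{- Let $D$ be a finite oriented graph (with at least one vertex) such that $\delta^+(D)\le 5$ or $at(D)\le 5$. Then $D$ has a strong Seymour vertex.
   Context: A digraph has no loops and no multiple arcs; $V(D)$ and $A(D)$ denote its vertex set and arc set. An oriented graph is a digraph without 2-cycles (i.e. $(u,v)$ and $(v,u)$ are never both arcs). For a vertex $v$, $N_D^+(v)=\{y:(v,y)\in A(D)\}$ is the set of out-neighbors, $d_D^+(v)=|N_D^+(v)|$ is the out-degree, and $\delta^+(D)$ is the minimum out-degree over all vertices. The second out-neighborhood of $v$ is $$N^{++}_D(v)=\{z\in V(D)\setminus (N_D^+(v)\cup\{v\}) : (v,y),(y,z)\in A(D)\text{ for some }y\in N_D^+(v)\}.$$ For disjoint vertex sets $X,Y$, a matching from $X$ to $Y$ is a set of arcs $(x_i,y_i)\in A(D)$ with $x_i\in X$, $y_i\in Y$, no two of which share an endpoint; it is a complete matching from $X$ to $Y$ if every vertex of $X$ is the tail of some arc of it (for $X=\emptyset$ the empty set is a complete matching). A vertex $x$ is a strong Seymour vertex of $D$ if there is a complete matching from $N^+_D(x)$ to $N^{++}_D(x)$. Paths are directed paths (with distinct vertices), and the length of a path is its number of arcs. For a positive integer $k$, $D$ is $k$-anti-transitive if $(v_0,v_k)\notin A(D)$ for every path $v_0v_1\cdots v_k$ of length $k$ in $D$. $at(D)$ denotes the smallest positive integer $k$ such that $D$ is $k$-anti-transitive. -}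

module Defs where

open import Data.Fin using (Fin; zero; suc; inject₁; fromℕ; funToFin; finToFun)
open import Data.Fin.Properties using (_≟_; all?; finToFun-funToFin; injective⇒≤)
open import Data.Nat using (ℕ; zero; suc; _≤_; _≤?_; _⊓_; z≤n; s≤s; _^_)
open import Data.Nat.Properties using (1+n≰n; ≤-trans; n≤1+n)
open import Data.Product using (∃; ∃-syntax; Σ-syntax; _×_; _,_; proj₁; proj₂)
open import Data.Vec using (tabulate; allFin; count; foldr₁)
open import Function using (_∘_)
open import Function.Definitions using (Injective)
open import Level using (0ℓ)
open import Relation.Binary using (Rel; Irreflexive; Asymmetric) renaming (Decidable to Decidable₂)
open import Relation.Binary.PropositionalEquality using (_≡_; _≢_; refl; sym; trans; subst₂)
open import Relation.Nullary using (Dec; yes; no; ¬_; contradiction)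
open import Relation.Nullary.Decidable using (map′; _×-dec_; _→-dec_; ¬?)
open import Relation.Unary using (Pred; Decidable; _∈_; _∪_; _∩_; ∁; ｛_｝)

-- Finite digraphs are taken on the vertex set Fin n. Decidability of Arc makes
-- the arc set a genuine finite set, so that out-degrees can be counted.
record Digraph (n : ℕ) : Set₁ where
  field
    Arc      : Rel (Fin n) 0ℓ
    arc?     : Decidable₂ Arc
    loopless : Irreflexive _≡_ Arc

  Vertex : Set
  Vertex = Fin n

  Oriented : Set
  Oriented = Asymmetric Arc

  N⁺ : Vertex → Pred Vertex 0ℓ
  N⁺ v y = Arc v y

  N⁺⁺ : Vertex → Pred Vertex 0ℓ
  N⁺⁺ v = ∁ (N⁺ v ∪ ｛ v ｝) ∩ λ z → ∃[ y ] (y ∈ N⁺ v × Arc y z)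

  d⁺ : Vertex → ℕ
  d⁺ v = count (arc? v) (allFin n)

  record IsMatching (X Y : Pred Vertex 0ℓ) (M : Pred (Vertex × Vertex) 0ℓ) : Set where
    field
      arcs     : ∀ {x y} → (x , y) ∈ M → x ∈ X × y ∈ Y × Arc x y
      disjoint : ∀ {x y x′ y′} → (x , y) ∈ M → (x′ , y′) ∈ M → (x , y) ≢ (x′ , y′) →
                 x ≢ x′ × x ≢ y′ × y ≢ x′ × y ≢ y′

  IsCompleteMatching : (X Y : Pred Vertex 0ℓ) → Pred (Vertex × Vertex) 0ℓ → Set
  IsCompleteMatching X Y M = IsMatching X Y M × (∀ {x} → x ∈ X → ∃[ y ] (x , y) ∈ M)

  StrongSeymour : Vertex → Set₁
  StrongSeymour x = Σ[ M ∈ Pred (Vertex × Vertex) 0ℓ ] IsCompleteMatching (N⁺ x) (N⁺⁺ x) M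

  IsPath : (k : ℕ) → (Fin (suc k) → Vertex) → Set
  IsPath k v = Injective _≡_ _≡_ v × (∀ (i : Fin k) → Arc (v (inject₁ i)) (v (suc i)))

  AntiTransitive : ℕ → Set
  AntiTransitive k = ∀ (v : Fin (suc k) → Vertex) → IsPath k v → ¬ Arc (v zero) (v (fromℕ k))

  isPath? : ∀ k → Decidable (IsPath k)
  isPath? k v =
    map′ (λ f {i} {j} → f i j) (λ f i j → f {i} {j})
         (all? λ i → all? λ j → (v i ≟ v j) →-dec (i ≟ j))
    ×-dec all? λ i → arc? (v (inject₁ i)) (v (suc i))

  -- Vertex sequences are enumerated through their codes in Fin (n ^ suc k).
  antiTransitive? : Decidable AntiTransitive
  antiTransitive? k =
    map′ fromCodes (λ at c → at (seq c))
         (all? λ c → isPath? k (seq c) →-dec ¬? (arc? (seq c zero) (seq c (fromℕ k))))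
    where
    seq : Fin (n ^ suc k) → Fin (suc k) → Vertex
    seq = finToFun

    fromCodes : (∀ c → IsPath k (seq c) → ¬ Arc (seq c zero) (seq c (fromℕ k))) →
                AntiTransitive k
    fromCodes h v (inj , path) a = h (funToFin v)
      ( (λ {i} {j} e → inj (trans (sym (eq i)) (trans e (eq j))))
      , (λ i → transport (inject₁ i) (suc i) (path i)) )
      (transport zero (fromℕ k) a)
      where
      eq : ∀ i → seq (funToFin v) i ≡ v i
      eq = finToFun-funToFin v

      transport : ∀ i j → Arc (v i) (v j) →
                  Arc (seq (funToFin v) i) (seq (funToFin v) j)
      transport i j = subst₂ Arc (sym (eq i)) (sym (eq j))

  -- A path of length suc n would need more than n distinct vertices.
  antiTransitive-large : AntiTransitive (suc n)
  antiTransitive-large v (inj , _) _ = 1+n≰n (≤-trans (n≤1+n _) (injective⇒≤ inj))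

IsLeast : Pred ℕ 0ℓ → Pred ℕ 0ℓ
IsLeast P m = P m × (∀ k → P k → m ≤ k)

least : ∀ {P : Pred ℕ 0ℓ} → Decidable P → ∀ k → P k → ∃ (IsLeast P)
least P? k pk with P? zero
... | yes p₀ = zero , p₀ , λ _ _ → z≤n
least P? zero    pk | no ¬p₀ = contradiction pk ¬p₀
least P? (suc k) pk | no ¬p₀ with least (P? ∘ suc) k pk
... | m , pm , min = suc m , pm , λ where
  zero    p₀ → contradiction p₀ ¬p₀
  (suc j) pj → s≤s (min j pj)

module _ {n : ℕ} (D : Digraph n) where
  open Digraph D

  PositiveAntiTransitive : Pred ℕ 0ℓ
  PositiveAntiTransitive k = 1 ≤ k × AntiTransitive k

  at-exists : ∃ (IsLeast PositiveAntiTransitive)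
  at-exists = least (λ k → (1 ≤? k) ×-dec antiTransitive? k)
                    (suc n) (s≤s z≤n , antiTransitive-large)

  at : ℕ
  at = proj₁ at-exists

  at-isLeast : IsLeast PositiveAntiTransitive at
  at-isLeast = proj₂ at-exists

-- The minimum is over a nonempty vertex set, hence the index suc n.
δ⁺ : ∀ {n} → Digraph (suc n) → ℕ
δ⁺ D = foldr₁ _⊓_ (tabulate (Digraph.d⁺ D))

{-# OPTIONS --safe #-}
-- By Hall's theorem a vertex v that is not strong Seymour has a violator: a set S of
-- out-neighbours and a disjoint set W, smaller than N v, such that all out-neighbours
-- of v and of S lie in S ∪ W. Let v have minimum out-degree δ. Then every s ∈ S has an
-- out-neighbour in S, and if s has only one, then s dominates W and has out-degree δ
-- again. If S has no path on 5 vertices (which at(D) ≤ 5 or δ ≤ 4 ensures), it contains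
-- an arc s → s′ whose ends both have just one out-neighbour in S. Passing to a violator
-- of s gives another such arc inside W, and comparing the two is contradictory.
-- For δ = 5 a similar comparison excludes such arcs, so S consists of all 5
-- out-neighbours of v. Counting arcs then forces S to be a regular tournament that
-- dominates the 4 vertices of W, and every vertex of S would be strong Seymour.
module Submission where

open import Defs
open import Data.Bool using (true; false; if_then_else_)
open import Data.Empty using (⊥; ⊥-elim)
open import Data.Fin using (Fin; zero; suc; inject₁; inject≤; fromℕ)
open import Data.Fin.Properties
  using (_≟_; any?; inject≤-injective; toℕ-injective; toℕ-inject≤; toℕ-inject₁)
open import Data.Fin.Subset
  using (Subset; inside; outside; _∈_; _∉_; _⊆_; _⊂_; _∪_; _∩_; _─_; _-_; ⁅_⁆; ∣_∣)
  renaming (⊥ to ∅)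
open import Data.Fin.Subset.Properties
open import Data.List using (List; []; _∷_; allFin; filter; length)
open import Data.List.Membership.Propositional using () renaming (_∈_ to _∈ₗ_)
open import Data.List.Membership.Propositional.Properties
  using (∈-allFin; ∈-filter⁺; ∈-filter⁻)
open import Data.List.Relation.Unary.All using (All; []; _∷_)
import Data.List.Relation.Unary.All as All
open import Data.List.Relation.Unary.AllPairs using ([]; _∷_)
open import Data.List.Relation.Unary.Any using (here; there)
open import Data.List.Relation.Unary.Unique.Propositional using (Unique)
open import Data.List.Relation.Unary.Unique.Propositional.Properties using (filter⁺; allFin⁺)
open import Data.Nat using (ℕ; zero; suc; _≤_; _<_; _+_; _*_; _⊓_; z≤n; s≤s; >-nonZero)
open import Data.Nat.Properties hiding (_≟_)
open import Data.Nat.Tactic.RingSolver using (solve-∀)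
open import Data.Product using (∃; _×_; _,_; proj₁; proj₂)
open import Data.Sum using (_⊎_; inj₁; inj₂; [_,_]′; map₂)
open import Data.Vec using (Vec; lookup; tabulate; count; foldr₁; []; _∷_; here; there)
open import Data.Vec.Properties using ([]=⇒lookup; lookup⇒[]=; lookup∘tabulate)
open import Data.Vec.Relation.Unary.All using ([]; _∷_)
open import Data.Vec.Relation.Unary.All.Properties using (lookup⁺)
open import Data.Vec.Relation.Unary.AllPairs using ([]; _∷_)
open import Data.Vec.Relation.Unary.Unique.Propositional using () renaming (Unique to VecUnique)
open import Data.Vec.Relation.Unary.Unique.Propositional.Properties using (lookup-injective)
open import Function using (_∘_; id)
open import Level using (0ℓ)
open import Relation.Binary.PropositionalEquality
open import Relation.Nullary using (yes; no; ¬_; contradiction; does)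
open import Relation.Nullary.Decidable using (_×-dec_; dec-true; ¬?; from-no)
open import Relation.Unary using (Pred; Decidable)

open import Algebra.Properties.Semiring.Sum +-*-semiring
  using (sum; ∑-distrib-+; ∑-comm; sum-cong-≗; *-distribˡ-sum; *-distribʳ-sum)

private variable
  n : ℕ
  x y z : Fin n
  p q r : Subset n

-- Finite sets and their cardinalities

x∈p─q⇒x∉q : ∀ (p q : Subset n) → x ∈ p ─ q → x ∉ q
x∈p─q⇒x∉q (_ ∷ p) (outside ∷ q) here        ()
x∈p─q⇒x∉q (_ ∷ p) (_ ∷ q)       (there x∈) (there x∈q) = x∈p─q⇒x∉q p q x∈ x∈q

∣p∪q∣+∣p∩q∣≡∣p∣+∣q∣ : ∀ (p q : Subset n) → ∣ p ∪ q ∣ + ∣ p ∩ q ∣ ≡ ∣ p ∣ + ∣ q ∣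
∣p∪q∣+∣p∩q∣≡∣p∣+∣q∣ []            []            = refl
∣p∪q∣+∣p∩q∣≡∣p∣+∣q∣ (inside ∷ p)  (inside ∷ q)  = cong suc
  (trans (+-suc _ _) (trans (cong suc (∣p∪q∣+∣p∩q∣≡∣p∣+∣q∣ p q)) (sym (+-suc _ _))))
∣p∪q∣+∣p∩q∣≡∣p∣+∣q∣ (inside ∷ p)  (outside ∷ q) = cong suc (∣p∪q∣+∣p∩q∣≡∣p∣+∣q∣ p q)
∣p∪q∣+∣p∩q∣≡∣p∣+∣q∣ (outside ∷ p) (inside ∷ q)  =
  trans (cong suc (∣p∪q∣+∣p∩q∣≡∣p∣+∣q∣ p q)) (sym (+-suc _ _))
∣p∪q∣+∣p∩q∣≡∣p∣+∣q∣ (outside ∷ p) (outside ∷ q) = ∣p∪q∣+∣p∩q∣≡∣p∣+∣q∣ p q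

∣p∪q∣≤∣p∣+∣q∣ : ∀ (p q : Subset n) → ∣ p ∪ q ∣ ≤ ∣ p ∣ + ∣ q ∣
∣p∪q∣≤∣p∣+∣q∣ p q = ≤-trans (m≤m+n _ _) (≤-reflexive (∣p∪q∣+∣p∩q∣≡∣p∣+∣q∣ p q))

∣p∣+∣q∣≤∣r∣+∣p∩q∣ : ∀ (p q : Subset n) → p ⊆ r → q ⊆ r → ∣ p ∣ + ∣ q ∣ ≤ ∣ r ∣ + ∣ p ∩ q ∣
∣p∣+∣q∣≤∣r∣+∣p∩q∣ {r = r} p q p⊆r q⊆r = begin
  ∣ p ∣ + ∣ q ∣         ≡⟨ sym (∣p∪q∣+∣p∩q∣≡∣p∣+∣q∣ p q) ⟩
  ∣ p ∪ q ∣ + ∣ p ∩ q ∣ ≤⟨ +-monoˡ-≤ _ (p⊆q⇒∣p∣≤∣q∣ p∪q⊆r) ⟩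
  ∣ r ∣ + ∣ p ∩ q ∣     ∎
  where
  open ≤-Reasoning
  p∪q⊆r : p ∪ q ⊆ r
  p∪q⊆r x∈ with x∈p∪q⁻ p q x∈
  ... | inj₁ x∈p = p⊆r x∈p
  ... | inj₂ x∈q = q⊆r x∈q

Empty⇒∣p∣≡0 : ∀ (p : Subset n) → (∀ {x} → x ∉ p) → ∣ p ∣ ≡ 0
Empty⇒∣p∣≡0 {n} p ∉p = trans (cong ∣_∣ (Empty-unique λ (_ , x∈p) → ∉p x∈p)) (∣⊥∣≡0 n)

∣p∣+∣q∣≤∣r∣ : ∀ (p q : Subset n) → p ⊆ r → q ⊆ r → (∀ {x} → x ∈ p → x ∉ q) →
             ∣ p ∣ + ∣ q ∣ ≤ ∣ r ∣
∣p∣+∣q∣≤∣r∣ {r = r} p q p⊆r q⊆r disj = ≤-trans (∣p∣+∣q∣≤∣r∣+∣p∩q∣ p q p⊆r q⊆r)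
  (≤-reflexive (trans (cong (∣ r ∣ +_) (Empty⇒∣p∣≡0 (p ∩ q) λ x∈ →
    let x∈p , x∈q = x∈p∩q⁻ p q x∈ in disj x∈p x∈q)) (+-identityʳ _)))

∣r∣≤∣r∩p∣+∣r∩q∣ : ∀ (r p q : Subset n) → (∀ {x} → x ∈ r → x ∈ p ⊎ x ∈ q) →
                 ∣ r ∣ ≤ ∣ r ∩ p ∣ + ∣ r ∩ q ∣
∣r∣≤∣r∩p∣+∣r∩q∣ r p q cover =
  ≤-trans (p⊆q⇒∣p∣≤∣q∣ r⊆) (∣p∪q∣≤∣p∣+∣q∣ (r ∩ p) (r ∩ q))
  where
  r⊆ : r ⊆ (r ∩ p) ∪ (r ∩ q)
  r⊆ x∈r with cover x∈r
  ... | inj₁ x∈p = x∈p∪q⁺ (inj₁ (x∈p∩q⁺ (x∈r , x∈p)))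
  ... | inj₂ x∈q = x∈p∪q⁺ (inj₂ (x∈p∩q⁺ (x∈r , x∈q)))

⟪_⟫ : {P : Pred (Fin n) 0ℓ} → Decidable P → Subset n
⟪ P? ⟫ = tabulate (does ∘ P?)

module _ {P : Pred (Fin n) 0ℓ} (P? : Decidable P) where

  ∈⟪⟫⁺ : P x → x ∈ ⟪ P? ⟫
  ∈⟪⟫⁺ {x} px =
    lookup⇒[]= x _ (trans (lookup∘tabulate (does ∘ P?) x) (dec-true (P? x) px))

  ∈⟪⟫⁻ : x ∈ ⟪ P? ⟫ → P x
  ∈⟪⟫⁻ {x} x∈ with P? x | trans (sym (lookup∘tabulate (does ∘ P?) x)) ([]=⇒lookup x∈)
  ... | yes px | _ = px

-- Hall's theorem

module _ (Γ : Fin n → Subset n) where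

  image? : ∀ S → Decidable λ y → ∃ λ x → x ∈ S × y ∈ Γ x
  image? S y = any? λ x → (x ∈? S) ×-dec (y ∈? Γ x)

  image : Subset n → Subset n
  image S = ⟪ image? S ⟫

  ∈-image⁺ : ∀ {S} → x ∈ S → y ∈ Γ x → y ∈ image S
  ∈-image⁺ {S = S} x∈S y∈Γx = ∈⟪⟫⁺ (image? S) (_ , x∈S , y∈Γx)

  ∈-image⁻ : ∀ {S} → y ∈ image S → ∃ λ x → x ∈ S × y ∈ Γ x
  ∈-image⁻ {S = S} = ∈⟪⟫⁻ (image? S)

  Matching : List (Fin n) → Set
  Matching xs = ∃ λ (f : Fin n → Fin n) →
    (∀ {x} → x ∈ₗ xs → f x ∈ Γ x) × (∀ {x y} → x ∈ₗ xs → y ∈ₗ xs → f x ≡ f y → x ≡ y)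

  Deficient : List (Fin n) → Set
  Deficient xs = ∃ λ S → (∀ {x} → x ∈ S → x ∈ₗ xs) × ∣ image S ∣ < ∣ S ∣

  Tight : List (Fin n) → Subset n → Set
  Tight xs S = (∀ {x} → x ∈ S → x ∈ₗ xs) × ∣ image S ∣ ≤ ∣ S ∣

  image-mono : p ⊆ q → image p ⊆ image q
  image-mono p⊆q y∈ = let _ , x∈ , e = ∈-image⁻ y∈ in ∈-image⁺ (p⊆q x∈) e

  -- Submodularity of the size of the image.
  tight-∪ : ∀ {xs A B} → Tight xs A → Tight xs B → Deficient xs ⊎ Tight xs (A ∪ B)
  tight-∪ {xs} {A} {B} (A⊆ , ∣A∣) (B⊆ , ∣B∣) with ∣ image (A ∩ B) ∣ <? ∣ A ∩ B ∣
  ... | yes def = inj₁ (A ∩ B , (λ x∈ → A⊆ (proj₁ (x∈p∩q⁻ A B x∈))) , def)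
  ... | no ¬def = inj₂ (∪⊆ , ∣∪∣)
    where
    open ≤-Reasoning
    ∪⊆ : ∀ {x} → x ∈ A ∪ B → x ∈ₗ xs
    ∪⊆ x∈ with x∈p∪q⁻ A B x∈
    ... | inj₁ x∈A = A⊆ x∈A
    ... | inj₂ x∈B = B⊆ x∈B
    image-∪ : image (A ∪ B) ⊆ image A ∪ image B
    image-∪ y∈ with ∈-image⁻ y∈
    ... | _ , x∈ , e with x∈p∪q⁻ A B x∈
    ...   | inj₁ x∈A = x∈p∪q⁺ (inj₁ (∈-image⁺ x∈A e))
    ...   | inj₂ x∈B = x∈p∪q⁺ (inj₂ (∈-image⁺ x∈B e))
    image-∩ : image (A ∩ B) ⊆ image A ∩ image B
    image-∩ y∈ = x∈p∩q⁺ (image-mono (p∩q⊆p A B) y∈ , image-mono (p∩q⊆q A B) y∈)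
    ∣∪∣ : ∣ image (A ∪ B) ∣ ≤ ∣ A ∪ B ∣
    ∣∪∣ = +-cancelʳ-≤ ∣ A ∩ B ∣ _ _ (begin
      ∣ image (A ∪ B) ∣ + ∣ A ∩ B ∣               ≤⟨ +-monoʳ-≤ _ (≮⇒≥ ¬def) ⟩
      ∣ image (A ∪ B) ∣ + ∣ image (A ∩ B) ∣
        ≤⟨ +-mono-≤ (p⊆q⇒∣p∣≤∣q∣ image-∪) (p⊆q⇒∣p∣≤∣q∣ image-∩) ⟩
      ∣ image A ∪ image B ∣ + ∣ image A ∩ image B ∣
        ≡⟨ ∣p∪q∣+∣p∩q∣≡∣p∣+∣q∣ (image A) (image B) ⟩
      ∣ image A ∣ + ∣ image B ∣                   ≤⟨ +-mono-≤ ∣A∣ ∣B∣ ⟩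
      ∣ A ∣ + ∣ B ∣                               ≡⟨ sym (∣p∪q∣+∣p∩q∣≡∣p∣+∣q∣ A B) ⟩
      ∣ A ∪ B ∣ + ∣ A ∩ B ∣                       ∎)

-- To match x, try every y ∈ Γ x in turn. If all of them fail, each lies in the
-- image of a tight subset of xs, and adding x to the union of these sets makes it
-- deficient.
hall : ∀ (xs : List (Fin n)) → Unique xs → ∀ Γ → Matching Γ xs ⊎ Deficient Γ xs
hall {n} []       _              Γ = inj₁ ((λ x → x) , (λ ()) , λ ())
hall {n} (x ∷ xs) (x∉xs ∷ uniq) Γ = conclude (attempt (allFin n))
  where
  x∉ : ∀ {z} → z ∈ₗ xs → x ≢ z
  x∉ = All.lookup x∉xs

  without : Fin n → Fin n → Subset n
  without y z = Γ z - y

  extend : ∀ {y} → y ∈ Γ x → Matching (without y) xs → Matching Γ (x ∷ xs)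
  extend {y} y∈Γx (f , f∈ , f-inj) = g , g∈ , g-inj
    where
    g : Fin n → Fin n
    g z with z ≟ x
    ... | yes _ = y
    ... | no  _ = f z
    f≢y : ∀ {z} → z ∈ₗ xs → f z ≢ y
    f≢y {z} z∈ eq = x∈p─q⇒x∉q (Γ z) ⁅ y ⁆ (f∈ z∈) (subst (_∈ ⁅ y ⁆) (sym eq) (x∈⁅x⁆ y))
    g-x : g x ≡ y
    g-x with x ≟ x
    ... | yes _ = refl
    ... | no x≢x = contradiction refl x≢x
    g-xs : ∀ {z} → z ∈ₗ xs → g z ≡ f z
    g-xs {z} z∈ with z ≟ x
    ... | yes refl = contradiction refl (x∉ z∈)
    ... | no  _    = refl
    g∈ : ∀ {z} → z ∈ₗ x ∷ xs → g z ∈ Γ z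
    g∈ (here refl) = subst (_∈ Γ x) (sym g-x) y∈Γx
    g∈ {z} (there z∈) = subst (_∈ Γ z) (sym (g-xs z∈)) (p─q⊆p (Γ z) ⁅ y ⁆ (f∈ z∈))
    g-inj : ∀ {a b} → a ∈ₗ x ∷ xs → b ∈ₗ x ∷ xs → g a ≡ g b → a ≡ b
    g-inj (here refl) (here refl) _  = refl
    g-inj (here refl) (there b∈)  eq =
      contradiction (trans (sym (g-xs b∈)) (trans (sym eq) g-x)) (f≢y b∈)
    g-inj (there a∈)  (here refl) eq =
      contradiction (trans (sym (g-xs a∈)) (trans eq g-x)) (f≢y a∈)
    g-inj (there a∈)  (there b∈)  eq =
      f-inj a∈ b∈ (trans (sym (g-xs a∈)) (trans eq (g-xs b∈)))

  -- Restoring `y` adds at most one element to the image of `S`, so `S` becomes tight. If `y` is not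
  -- in that image, nothing is added and `S` stays deficient.
  tight : ∀ {y} → Deficient (without y) xs →
          Deficient Γ xs ⊎ ∃ λ S → Tight Γ xs S × y ∈ image Γ S
  tight {y} (S , S⊆ , def) with y ∈? image Γ S
  ... | yes y∈ = inj₂ (S , (S⊆ , ≤-trans ∣image∣ (≤-trans (s≤s (p⊆q⇒∣p∣≤∣q∣ sub)) def)) , y∈)
    where
    sub : image Γ S - y ⊆ image (without y) S
    sub z∈ = let _ , w∈ , e = ∈-image⁻ Γ (p─q⊆p _ _ z∈) in
      ∈-image⁺ (without y) w∈ (x∈p∧x≢y⇒x∈p-y e λ where
        refl → x∈p─q⇒x∉q (image Γ S) ⁅ y ⁆ z∈ (x∈⁅x⁆ y))
    ∣image∣ : ∣ image Γ S ∣ ≤ suc ∣ image Γ S - y ∣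
    ∣image∣ = ≤-trans (p⊆q⇒∣p∣≤∣q∣ cover) (≤-trans (∣p∪q∣≤∣p∣+∣q∣ ⁅ y ⁆ _)
      (≤-reflexive (cong (_+ ∣ image Γ S - y ∣) (∣⁅x⁆∣≡1 y))))
      where
      cover : image Γ S ⊆ ⁅ y ⁆ ∪ (image Γ S - y)
      cover {z} z∈ with z ≟ y
      ... | yes refl = x∈p∪q⁺ (inj₁ (x∈⁅x⁆ y))
      ... | no z≢y   = x∈p∪q⁺ (inj₂ (x∈p∧x≢y⇒x∈p-y z∈ z≢y))
  ... | no y∉ = inj₁ (S , S⊆ , ≤-trans (s≤s (p⊆q⇒∣p∣≤∣q∣ sub)) def)
    where
    sub : image Γ S ⊆ image (without y) S
    sub z∈ = let _ , w∈ , e = ∈-image⁻ Γ z∈ in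
      ∈-image⁺ (without y) w∈ (x∈p∧x≢y⇒x∈p-y e λ where refl → y∉ z∈)

  Outcome : List (Fin n) → Set
  Outcome ys = (Matching Γ (x ∷ xs) ⊎ Deficient Γ xs) ⊎
               ∃ λ S → Tight Γ xs S × All (λ y → y ∈ Γ x → y ∈ image Γ S) ys

  attempt : ∀ ys → Outcome ys
  attempt [] = inj₂ (∅ , ((λ z∈ → contradiction z∈ ∉⊥) ,
    ≤-trans (≤-reflexive (Empty⇒∣p∣≡0 (image Γ ∅)
      λ y∈ → let _ , w∈ , _ = ∈-image⁻ Γ y∈ in ∉⊥ w∈)) z≤n) , [])
  attempt (y ∷ ys) with attempt ys
  ... | inj₁ done = inj₁ done
  ... | inj₂ (A , A-tight , ys∈) with y ∈? Γ x
  ...   | no y∉Γx = inj₂ (A , A-tight , (λ y∈Γx → contradiction y∈Γx y∉Γx) ∷ ys∈)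
  ...   | yes y∈Γx with hall xs uniq (without y)
  ...     | inj₁ m = inj₁ (inj₁ (extend y∈Γx m))
  ...     | inj₂ def with tight def
  ...       | inj₁ d = inj₁ (inj₂ d)
  ...       | inj₂ (B , B-tight , y∈B) with tight-∪ Γ A-tight B-tight
  ...         | inj₁ d = inj₁ (inj₂ d)
  ...         | inj₂ t = inj₂ (A ∪ B , t , (λ _ → image-mono Γ (q⊆p∪q A B) y∈B) ∷
                               All.map (λ f e → image-mono Γ (p⊆p∪q B) (f e)) ys∈)

  conclude : Outcome (allFin n) → Matching Γ (x ∷ xs) ⊎ Deficient Γ (x ∷ xs)
  conclude (inj₁ (inj₁ m)) = inj₁ m
  conclude (inj₁ (inj₂ (S , S⊆ , def))) = inj₂ (S , there ∘ S⊆ , def)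
  conclude (inj₂ (S , (S⊆ , ∣S∣) , Γx⊆)) = inj₂ (S ∪ ⁅ x ⁆ , ∪⊆ , (begin-strict
    ∣ image Γ (S ∪ ⁅ x ⁆) ∣ ≤⟨ p⊆q⇒∣p∣≤∣q∣ image⊆ ⟩
    ∣ image Γ S ∣           ≤⟨ ∣S∣ ⟩
    ∣ S ∣                   <⟨ p⊂q⇒∣p∣<∣q∣ (p⊆p∪q ⁅ x ⁆ , x , x∈∪ , λ x∈ → x∉ (S⊆ x∈) refl) ⟩
    ∣ S ∪ ⁅ x ⁆ ∣           ∎))
    where
    open ≤-Reasoning
    x∈∪ : x ∈ S ∪ ⁅ x ⁆
    x∈∪ = q⊆p∪q S ⁅ x ⁆ (x∈⁅x⁆ x)
    ∪⊆ : ∀ {z} → z ∈ S ∪ ⁅ x ⁆ → z ∈ₗ x ∷ xs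
    ∪⊆ z∈ with x∈p∪q⁻ S ⁅ x ⁆ z∈
    ... | inj₁ z∈S = there (S⊆ z∈S)
    ... | inj₂ z∈x = here (x∈⁅y⁆⇒x≡y x z∈x)
    image⊆ : image Γ (S ∪ ⁅ x ⁆) ⊆ image Γ S
    image⊆ y∈ with ∈-image⁻ Γ y∈
    ... | w , w∈ , e with x∈p∪q⁻ S ⁅ x ⁆ w∈
    ...   | inj₁ w∈S = ∈-image⁺ Γ w∈S e
    ...   | inj₂ w∈x with x∈⁅y⁆⇒x≡y x w∈x
    ...     | refl = All.lookup Γx⊆ (∈-allFin _) e

-- Counting arcs inside a vertex set

sum-mono-≤ : ∀ {n} {f g : Fin n → ℕ} → (∀ i → f i ≤ g i) → sum f ≤ sum g
sum-mono-≤ {zero}  f≤g = z≤n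
sum-mono-≤ {suc n} f≤g = +-mono-≤ (f≤g zero) (sum-mono-≤ (f≤g ∘ suc))

χ : Subset n → Fin n → ℕ
χ p x = if lookup p x then 1 else 0

χ-∈ : x ∈ p → χ p x ≡ 1
χ-∈ x∈p rewrite []=⇒lookup x∈p = refl

χ-∉ : x ∉ p → χ p x ≡ 0
χ-∉ {x = x} {p = p} x∉p with lookup p x in eq
... | true  = contradiction (lookup⇒[]= x p eq) x∉p
... | false = refl

χ≤1 : ∀ (p : Subset n) x → χ p x ≤ 1
χ≤1 p x with lookup p x
... | true  = ≤-refl
... | false = z≤n

sum-χ : ∀ (p : Subset n) → sum (χ p) ≡ ∣ p ∣
sum-χ []            = refl
sum-χ (inside ∷ p)  = cong suc (sum-χ p)
sum-χ (outside ∷ p) = sum-χ p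

module _ (N : Fin n → Subset n) (asym : ∀ {x y} → y ∈ N x → x ∉ N y) (C : Subset n) where

  private
    -- The adjacency matrix of the subgraph induced on `C`.
    arc : Fin n → Fin n → ℕ
    arc x y = χ C x * χ (N x ∩ C) y

    arc-∉ : x ∉ C → arc x y ≡ 0
    arc-∉ x∉ rewrite χ-∉ x∉ = refl

    arc-∉ʳ : y ∉ N x ∩ C → arc x y ≡ 0
    arc-∉ʳ {x = x} y∉ rewrite χ-∉ y∉ = *-zeroʳ (χ C x)

    arc≤1 : ∀ x y → arc x y ≤ 1
    arc≤1 x y = *-mono-≤ (χ≤1 C x) (χ≤1 (N x ∩ C) y)

    -- Distinct vertices are joined by at most one arc and there are no loops; the last summand
    -- fills the diagonal.
    arcs≤1 : ∀ x y → x ∈ C → y ∈ C → arc x y + arc y x + χ C x * χ ⁅ x ⁆ y ≤ 1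
    arcs≤1 x y x∈ y∈ with y ≟ x
    ... | yes refl rewrite arc-∉ʳ {x} {x} (λ x∈N → let e = p∩q⊆p (N x) C x∈N in asym e e) =
      *-mono-≤ (χ≤1 C x) (χ≤1 ⁅ x ⁆ x)
    ... | no y≢x rewrite χ-∉ (y≢x ∘ x∈⁅y⁆⇒x≡y {x = y} x) | *-zeroʳ (χ C x)
                       | +-identityʳ (arc x y + arc y x) with y ∈? N x
    ...   | yes xy rewrite arc-∉ʳ {x} {y} (asym xy ∘ p∩q⊆p (N y) C)
                         | +-identityʳ (arc x y) = arc≤1 x y
    ...   | no ¬xy rewrite arc-∉ʳ {y} {x} (¬xy ∘ p∩q⊆p (N x) C) = arc≤1 y x

    arcs≤ : ∀ x y → arc x y + arc y x + χ C x * χ ⁅ x ⁆ y ≤ χ C x * χ C y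
    arcs≤ x y with x ∈? C | y ∈? C
    ... | yes x∈ | yes y∈ = ≤-trans (arcs≤1 x y x∈ y∈)
      (≤-reflexive (sym (cong₂ _*_ (χ-∈ x∈) (χ-∈ y∈))))
    ... | no x∉  | _      rewrite arc-∉ {x} {y} x∉ | arc-∉ʳ {x} {y} (x∉ ∘ p∩q⊆q (N y) C)
                                | χ-∉ x∉ = z≤n
    ... | yes x∈ | no y∉  rewrite arc-∉ {y} {x} y∉ | arc-∉ʳ {y} {x} (y∉ ∘ p∩q⊆q (N x) C)
                                | χ-∉ {x = y} {p = ⁅ x ⁆} (λ y∈ → y∉ (subst (_∈ C) (sym (x∈⁅y⁆⇒x≡y x y∈)) x∈))
                                | *-zeroʳ (χ C x) = z≤n

    row : ∀ x → χ C x * ∣ N x ∩ C ∣ + sum (λ y → arc y x) + χ C x ≤ χ C x * ∣ C ∣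
    row x = begin
      χ C x * ∣ N x ∩ C ∣ + sum (λ y → arc y x) + χ C x
        ≡⟨ cong₂ _+_ (cong (_+ sum (λ y → arc y x)) (scale (N x ∩ C)))
                     (trans (trans (sym (*-identityʳ _)) (cong (χ C x *_) (sym (∣⁅x⁆∣≡1 x))))
                            (scale ⁅ x ⁆)) ⟩
      sum (arc x) + sum (λ y → arc y x) + sum (λ y → χ C x * χ ⁅ x ⁆ y)
        ≡⟨ cong (_+ _) (sym (∑-distrib-+ (arc x) (λ y → arc y x))) ⟩
      sum (λ y → arc x y + arc y x) + sum (λ y → χ C x * χ ⁅ x ⁆ y)
        ≡⟨ sym (∑-distrib-+ (λ y → arc x y + arc y x) _) ⟩
      sum (λ y → arc x y + arc y x + χ C x * χ ⁅ x ⁆ y)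
        ≤⟨ sum-mono-≤ (arcs≤ x) ⟩
      sum (λ y → χ C x * χ C y)
        ≡⟨ sym (scale C) ⟩
      χ C x * ∣ C ∣ ∎
      where
      open ≤-Reasoning
      scale : ∀ p → χ C x * ∣ p ∣ ≡ sum (λ y → χ C x * χ p y)
      scale p = trans (cong (χ C x *_) (sym (sum-χ p))) (*-distribˡ-sum (χ C x) (χ p))

  -- This is the bound of k(k - 1)/2 arcs on k vertices, free of division and subtraction. `g`
  -- bounds the out-degrees inside `C` from below and vanishes outside `C`.
  arcs-inside : ∀ (g : Fin n → ℕ) → (∀ x → g x ≤ χ C x * ∣ N x ∩ C ∣) →
                sum g + sum g + ∣ C ∣ ≤ ∣ C ∣ * ∣ C ∣
  arcs-inside g g≤ = begin
    sum g + sum g + ∣ C ∣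
      ≤⟨ +-monoˡ-≤ ∣ C ∣ (+-mono-≤ (sum-mono-≤ g≤) (sum-mono-≤ g≤)) ⟩
    sum out + sum out + ∣ C ∣
      ≡⟨ cong₂ _+_ (cong (sum out +_) out≡in) (sym (sum-χ C)) ⟩
    sum out + sum inn + sum (χ C)
      ≡⟨ cong (_+ sum (χ C)) (sym (∑-distrib-+ out inn)) ⟩
    sum (λ x → out x + inn x) + sum (χ C)
      ≡⟨ sym (∑-distrib-+ (λ x → out x + inn x) (χ C)) ⟩
    sum (λ x → out x + inn x + χ C x)
      ≤⟨ sum-mono-≤ row ⟩
    sum (λ x → χ C x * ∣ C ∣)
      ≡⟨ sym (*-distribʳ-sum ∣ C ∣ (χ C)) ⟩
    sum (χ C) * ∣ C ∣
      ≡⟨ cong (_* ∣ C ∣) (sum-χ C) ⟩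
    ∣ C ∣ * ∣ C ∣ ∎
    where
    open ≤-Reasoning
    out inn : Fin n → ℕ
    out x = χ C x * ∣ N x ∩ C ∣
    inn x = sum (λ y → arc y x)
    -- Double counting: out-degrees and in-degrees both count the arcs inside `C`.
    out≡in : sum out ≡ sum inn
    out≡in = trans (sum-cong-≗ λ x → trans (cong (χ C x *_) (sym (sum-χ (N x ∩ C))))
      (*-distribˡ-sum (χ C x) (χ (N x ∩ C)))) (∑-comm arc)

  private
    twice : ∀ x → (x ∈ C → 2 ≤ ∣ N x ∩ C ∣) → χ C x * 2 ≤ χ C x * ∣ N x ∩ C ∣
    twice x two with x ∈? C
    ... | yes x∈ = *-monoʳ-≤ (χ C x) (two x∈)
    ... | no x∉ rewrite χ-∉ x∉ = z≤n

    sum-twice : sum (λ x → χ C x * 2) ≡ ∣ C ∣ * 2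
    sum-twice = trans (sym (*-distribʳ-sum 2 (χ C))) (cong (_* 2) (sum-χ C))

  -- With at least 2 arcs leaving each of k vertices, the arc bound gives 5k ≤ k * k.
  outdegree-2⇒5≤∣C∣ : x ∈ C → (∀ {y} → y ∈ C → 2 ≤ ∣ N y ∩ C ∣) → 5 ≤ ∣ C ∣
  outdegree-2⇒5≤∣C∣ x∈ two = *-cancelˡ-≤ ∣ C ∣ {{>-nonZero C-pos}} (begin
    ∣ C ∣ * 5                               ≡⟨ *-comm ∣ C ∣ 5 ⟩
    5 * ∣ C ∣                               ≡⟨ five ∣ C ∣ ⟩
    ∣ C ∣ * 2 + ∣ C ∣ * 2 + ∣ C ∣             ≡⟨ cong (λ k → k + k + ∣ C ∣) (sym sum-twice) ⟩
    sum (λ x → χ C x * 2) + sum (λ x → χ C x * 2) + ∣ C ∣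
      ≤⟨ arcs-inside (λ x → χ C x * 2) (λ x → twice x two) ⟩
    ∣ C ∣ * ∣ C ∣                            ∎)
    where
    open ≤-Reasoning
    C-pos : 0 < ∣ C ∣
    C-pos = ≤-trans (s≤s z≤n) (x∈p⇒∣p-x∣<∣p∣ x∈)
    five : ∀ k → 5 * k ≡ k * 2 + k * 2 + k
    five = solve-∀

  -- One out-degree above 2 would make at least 2 * 5 + 1 = 11 arcs on 5 vertices, which have only
  -- 10 pairs; in doubled form, 11 + 11 + 5 = 27 exceeds 25.
  outdegree≤2 : ∣ C ∣ ≡ 5 → (∀ {y} → y ∈ C → 2 ≤ ∣ N y ∩ C ∣) → x ∈ C → ∣ N x ∩ C ∣ ≤ 2
  outdegree≤2 {x} five two x∈ with ∣ N x ∩ C ∣ ≤? 2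
  ... | yes ≤2 = ≤2
  ... | no ≰2 = contradiction 27≤25 (from-no (27 ≤? 25))
    where
    g : Fin n → ℕ
    g y = χ C y * 2 + χ ⁅ x ⁆ y
    g≤ : ∀ y → g y ≤ χ C y * ∣ N y ∩ C ∣
    g≤ y with y ≟ x
    ... | yes refl rewrite χ-∈ x∈ | χ-∈ (x∈⁅x⁆ x) | +-identityʳ ∣ N x ∩ C ∣ = ≰⇒> ≰2
    ... | no y≢x rewrite χ-∉ (y≢x ∘ x∈⁅y⁆⇒x≡y {x = y} x) | +-identityʳ (χ C y * 2) = twice y two
    sum-g : sum g ≡ 11
    sum-g = trans (∑-distrib-+ (λ y → χ C y * 2) (χ ⁅ x ⁆))
      (cong₂ _+_ (trans sum-twice (cong (_* 2) five)) (trans (sum-χ ⁅ x ⁆) (∣⁅x⁆∣≡1 x)))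
    27≤25 : 27 ≤ 25
    27≤25 = subst₂ _≤_ (cong₂ (λ s c → s + s + c) sum-g five) (cong (λ c → c * c) five)
                   (arcs-inside g g≤)

k+m≤a+b∧b≤m⇒k≤a : ∀ k m {a b} → k + m ≤ a + b → b ≤ m → k ≤ a
k+m≤a+b∧b≤m⇒k≤a k m {a} le b≤m = +-cancelʳ-≤ m k a (≤-trans le (+-monoʳ-≤ a b≤m))

k+m≤a+b∧a≤k⇒m≤b : ∀ k m {a b} → k + m ≤ a + b → a ≤ k → m ≤ b
k+m≤a+b∧a≤k⇒m≤b k m {a} {b} le a≤k = +-cancelˡ-≤ k m b (≤-trans le (+-monoˡ-≤ b a≤k))

-- If x and y were not adjacent, the arc from x to y could be added and the resulting
-- oriented graph would violate outdegree≤2.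
5-vertex-tournament : ∀ (N : Fin n → Subset n) (asym : ∀ {x y} → y ∈ N x → x ∉ N y)
  (C : Subset n) → ∣ C ∣ ≡ 5 → (∀ {y} → y ∈ C → 2 ≤ ∣ N y ∩ C ∣) →
  x ∈ C → y ∈ C → x ≢ y → y ∈ N x ⊎ x ∈ N y
5-vertex-tournament {n} {x} {y} N asym C five two x∈C y∈C x≢y with y ∈? N x | x ∈? N y
... | yes xy | _      = inj₁ xy
... | no _   | yes yx = inj₂ yx
... | no ¬xy | no ¬yx = contradiction
    (≤-trans (p⊂q⇒∣p∣<∣q∣ N⊂N+) (outdegree≤2 N+ asym+ C five two+ x∈C)) (<⇒≱ (s≤s (two x∈C)))
  where
  N+ : Fin n → Subset n
  N+ z with z ≟ x
  ... | yes _ = N x ∪ ⁅ y ⁆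
  ... | no  _ = N z
  N⊆N+ : ∀ z → N z ⊆ N+ z
  N⊆N+ z with z ≟ x
  ... | yes refl = p⊆p∪q ⁅ y ⁆
  ... | no _     = λ w∈ → w∈
  y∈N+x : y ∈ N+ x
  y∈N+x with x ≟ x
  ... | yes _  = q⊆p∪q (N x) ⁅ y ⁆ (x∈⁅x⁆ y)
  ... | no x≢x = contradiction refl x≢x
  x∉N+ : ∀ {z} → x ∈ N z → z ∉ N x ∪ ⁅ y ⁆
  x∉N+ zx z∈ with x∈p∪q⁻ (N x) ⁅ y ⁆ z∈
  ... | inj₁ xz = asym xz zx
  ... | inj₂ z∈y with x∈⁅y⁆⇒x≡y y z∈y
  ...   | refl = ¬yx zx
  asym+ : ∀ {a b} → b ∈ N+ a → a ∉ N+ b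
  asym+ {a} {b} ab ba with a ≟ x | b ≟ x
  ... | no _     | no _     = asym ab ba
  ... | no _     | yes refl = x∉N+ ab ba
  ... | yes refl | no _     = x∉N+ ba ab
  ... | yes refl | yes refl with x∈p∪q⁻ (N x) ⁅ y ⁆ ab
  ...   | inj₁ xx  = asym xx xx
  ...   | inj₂ x∈y = x≢y (x∈⁅y⁆⇒x≡y y x∈y)
  two+ : ∀ {z} → z ∈ C → 2 ≤ ∣ N+ z ∩ C ∣
  two+ {z} z∈C = ≤-trans (two z∈C) (p⊆q⇒∣p∣≤∣q∣ λ w∈ →
    let zw , w∈C = x∈p∩q⁻ (N z) C w∈ in x∈p∩q⁺ (N⊆N+ z zw , w∈C))
  N⊂N+ : (N x ∩ C) ⊂ (N+ x ∩ C)
  N⊂N+ = (λ w∈ → let xw , w∈C = x∈p∩q⁻ (N x) C w∈ in x∈p∩q⁺ (N⊆N+ x xw , w∈C)) ,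
         y , x∈p∩q⁺ (y∈N+x , y∈C) , ¬xy ∘ p∩q⊆p (N x) C

-- Turns a few named elements of `p` outside `q` into an upper bound for the size of `q`, by
-- deleting them from `p` one at a time.
length+∣q∣≤∣p∣ : ∀ (xs : List (Fin n)) → Unique xs → All (_∈ p) xs → q ⊆ p → All (_∉ q) xs →
                length xs + ∣ q ∣ ≤ ∣ p ∣
length+∣q∣≤∣p∣ []       _              _             q⊆p _ = p⊆q⇒∣p∣≤∣q∣ q⊆p
length+∣q∣≤∣p∣ (x ∷ xs) (x∉xs ∷ uniq) (x∈p ∷ xs∈p) q⊆p (x∉q ∷ xs∉q) = ≤-trans
  (s≤s (length+∣q∣≤∣p∣ xs uniq
    (All.zipWith (λ (y∈p , x≢y) → x∈p∧x≢y⇒x∈p-y y∈p (≢-sym x≢y)) (xs∈p , x∉xs))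
    (λ y∈q → x∈p∧x≢y⇒x∈p-y (q⊆p y∈q) λ where refl → x∉q y∈q) xs∉q))
  (x∈p⇒∣p-x∣<∣p∣ x∈p)

length≤∣p∣ : ∀ (xs : List (Fin n)) → Unique xs → All (_∈ p) xs → length xs ≤ ∣ p ∣
length≤∣p∣ xs uniq xs∈p = ≤-trans (m≤m+n (length xs) _)
  (length+∣q∣≤∣p∣ xs uniq xs∈p (λ y∈ → contradiction y∈ ∉⊥) (All.map (λ _ → ∉⊥) xs∈p))

-- Short paths in oriented graphs

module OrientedGraph (N : Fin n → Subset n) (asym : ∀ {x y} → y ∈ N x → x ∉ N y) where

  infix 4 _⟶_
  _⟶_ : Fin n → Fin n → Set
  x ⟶ y = y ∈ N x

  ⟶⇒≢ : x ⟶ y → x ≢ y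
  ⟶⇒≢ xy refl = asym xy xy

  ⟶⟶⇒≢ : x ⟶ y → y ⟶ z → x ≢ z
  ⟶⟶⇒≢ xy yz refl = asym xy yz

  -- The number in the name counts vertices. Asymmetry makes vertices at
  -- distance one or two along a walk distinct, so only the other pairs are listed.
  P4free P5free : Subset n → Set
  P4free C = ∀ {a b c d} → a ∈ C → b ∈ C → c ∈ C → d ∈ C →
             a ⟶ b → b ⟶ c → c ⟶ d → a ≢ d → ⊥
  P5free C = ∀ {a b c d e} → a ∈ C → b ∈ C → c ∈ C → d ∈ C → e ∈ C →
             a ⟶ b → b ⟶ c → c ⟶ d → d ⟶ e → a ≢ d → b ≢ e → a ≢ e → ⊥

  P5free-⊆ : ∀ {C C′} → C ⊆ C′ → P5free C′ → P5free C
  P5free-⊆ C⊆ free a∈ b∈ c∈ d∈ e∈ = free (C⊆ a∈) (C⊆ b∈) (C⊆ c∈) (C⊆ d∈) (C⊆ e∈)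

  ∣C∣≤4⇒P5free : ∀ {C} → ∣ C ∣ ≤ 4 → P5free C
  ∣C∣≤4⇒P5free {C} ∣C∣≤4 {a} {b} {c} {d} {e} a∈ b∈ c∈ d∈ e∈ ab bc cd de a≢d b≢e a≢e =
    <⇒≱ (s≤s ∣C∣≤4) (length≤∣p∣ (a ∷ b ∷ c ∷ d ∷ e ∷ [])
      ((⟶⇒≢ ab ∷ ⟶⟶⇒≢ ab bc ∷ a≢d ∷ a≢e ∷ []) ∷ (⟶⇒≢ bc ∷ ⟶⟶⇒≢ bc cd ∷ b≢e ∷ []) ∷
       (⟶⇒≢ cd ∷ ⟶⟶⇒≢ cd de ∷ []) ∷ (⟶⇒≢ de ∷ []) ∷ [] ∷ [])
      (a∈ ∷ b∈ ∷ c∈ ∷ d∈ ∷ e∈ ∷ []))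

  record SoleOut (C : Subset n) (x y : Fin n) : Set where
    constructor soleOut
    field
      target : y ∈ C
      arc    : x ⟶ y
      only   : ∀ {o} → o ∈ C → x ⟶ o → o ≡ y

  open SoleOut

  soleOrOther : ∀ C {x y} → y ∈ C → x ⟶ y →
                SoleOut C x y ⊎ ∃ λ o → o ∈ C × x ⟶ o × o ≢ y
  soleOrOther C {x} {y} y∈ xy
    with any? (λ o → (o ∈? C) ×-dec ((o ∈? N x) ×-dec ¬? (o ≟ y)))
  ... | yes other = inj₂ other
  ... | no none   = inj₁ (soleOut y∈ xy only′)
    where
    only′ : ∀ {o} → o ∈ C → x ⟶ o → o ≡ y
    only′ {o} o∈ xo with o ≟ y
    ... | yes o≡y = o≡y
    ... | no o≢y  = contradiction (o , o∈ , xo , o≢y) none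

  -- Not closure under out-neighbours: the subgraph induced on `C` merely has no sink.
  Closed : Subset n → Set
  Closed C = ∀ {x} → x ∈ C → ∃ λ y → y ∈ C × x ⟶ y

  -- Two further arcs inside `C` must lead back to `x`, closing a triangle x → y → z → x. A second
  -- out-neighbour `o` of `x` would end a path y → z → x → o.
  P4free⇒sole : ∀ {C} → Closed C → P4free C → x ∈ C → y ∈ C → x ⟶ y → SoleOut C x y
  P4free⇒sole {x} {y} {C} closed free x∈ y∈ xy with closed y∈
  ... | z , z∈ , yz with closed z∈
  ...   | w , w∈ , zw with x ≟ w
  ...     | no x≢w  = contradiction x≢w (free x∈ y∈ z∈ w∈ xy yz zw)
  ...     | yes refl = soleOut y∈ xy only′
    where
    only′ : ∀ {o} → o ∈ C → x ⟶ o → o ≡ y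
    only′ {o} o∈ xo with y ≟ o
    ... | yes refl = refl
    ... | no y≢o   = contradiction y≢o (free y∈ z∈ x∈ o∈ yz zw xo)

  NoSolePair : Subset n → Set
  NoSolePair C = ∀ {x y z} → x ∈ C → SoleOut C x y → SoleOut C y z → ⊥

  module _ {C : Subset n} (closed : Closed C) (free : P5free C) (noPair : NoSolePair C) where

    private
      -- Started one step later on the 4-cycle, b → c → d → a → o is a path on five vertices unless
      -- `o` is `c`.
      around : ∀ {a b c d o} → a ∈ C → b ∈ C → c ∈ C → d ∈ C → o ∈ C →
               a ⟶ b → b ⟶ c → c ⟶ d → d ⟶ a → a ⟶ o → o ≢ b → o ≡ c
      around {c = c} {o = o} a∈ b∈ c∈ d∈ o∈ ab bc cd da ao o≢b with o ≟ c
      ... | yes o≡c = o≡c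
      ... | no o≢c  = contradiction (≢-sym o≢b) (free b∈ c∈ d∈ a∈ o∈ bc cd da ao
                        (≢-sym (⟶⇒≢ ab)) (≢-sym o≢c))

      around-sole : ∀ {a b c d} → a ∈ C → b ∈ C → c ∈ C → d ∈ C →
                    a ⟶ b → b ⟶ c → c ⟶ d → d ⟶ a → ¬ a ⟶ c → SoleOut C a b
      around-sole {a} {b} a∈ b∈ c∈ d∈ ab bc cd da ¬ac with soleOrOther C b∈ ab
      ... | inj₁ sole = sole
      ... | inj₂ (o , o∈ , ao , o≢b) = contradiction
        (subst (a ⟶_) (around a∈ b∈ c∈ d∈ o∈ ab bc cd da ao o≢b) ao) ¬ac

      -- A diagonal carries at most one arc. So `c` has no outgoing chord, nor has one of its cycle
      -- neighbours `b` and `d`; the cycle arcs leaving these two consecutive vertices form a sole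
      -- pair.
      ¬chorded-4-cycle : ∀ {a b c d} → a ∈ C → b ∈ C → c ∈ C → d ∈ C →
                         a ⟶ b → b ⟶ c → c ⟶ d → d ⟶ a → ¬ a ⟶ c
      ¬chorded-4-cycle {a} {b} {c} {d} a∈ b∈ c∈ d∈ ab bc cd da ac with b ∈? N d
      ... | no ¬db = noPair c∈ (around-sole c∈ d∈ a∈ b∈ cd da ab bc (asym ac))
                               (around-sole d∈ a∈ b∈ c∈ da ab bc cd ¬db)
      ... | yes db = noPair b∈ (around-sole b∈ c∈ d∈ a∈ bc cd da ab (asym db))
                               (around-sole c∈ d∈ a∈ b∈ cd da ab bc (asym ac))

      ¬4-cycle : ∀ {a b c d} → a ∈ C → b ∈ C → c ∈ C → d ∈ C →
                 a ⟶ b → b ⟶ c → c ⟶ d → ¬ d ⟶ a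
      ¬4-cycle a∈ b∈ c∈ d∈ ab bc cd da =
        noPair a∈ (around-sole a∈ b∈ c∈ d∈ ab bc cd da (¬chorded-4-cycle a∈ b∈ c∈ d∈ ab bc cd da))
                  (around-sole b∈ c∈ d∈ a∈ bc cd da ab (¬chorded-4-cycle b∈ c∈ d∈ a∈ bc cd da ab))

      -- An out-neighbour of `d` is not `c` by asymmetry, not `a` as this closes a 4-cycle, and not
      -- a new vertex as this makes a path on five; only `b` remains.
      P4-end : ∀ {a b c d} → a ∈ C → b ∈ C → c ∈ C → d ∈ C →
               a ⟶ b → b ⟶ c → c ⟶ d → a ≢ d → SoleOut C d b
      P4-end {a} {b} {c} {d} a∈ b∈ c∈ d∈ ab bc cd a≢d =
        let _ , o∈ , do′ = closed d∈ in soleOut b∈ (subst (d ⟶_) (back o∈ do′) do′) back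
        where
        back : ∀ {o} → o ∈ C → d ⟶ o → o ≡ b
        back {o} o∈ do′ with o ≟ b | o ≟ a
        ... | yes o≡b | _        = o≡b
        ... | no _    | yes refl = contradiction do′ (¬4-cycle a∈ b∈ c∈ d∈ ab bc cd)
        ... | no o≢b  | no o≢a   = contradiction (≢-sym o≢a)
          (free a∈ b∈ c∈ d∈ o∈ ab bc cd do′ a≢d (≢-sym o≢b))

      -- By `P4-end`, `d` has the sole out-neighbour `b`. If `b` has an out-neighbour `q` besides
      -- `c`, the path c → d → b → q makes q → d → b a sole pair; otherwise d → b → c is one.
      p4free : P4free C
      p4free {a} {b} {c} {d} a∈ b∈ c∈ d∈ ab bc cd a≢d with soleOrOther C c∈ bc
      ... | inj₁ sole = noPair d∈ d→b sole
        where d→b = P4-end a∈ b∈ c∈ d∈ ab bc cd a≢d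
      ... | inj₂ (q , q∈ , bq , q≢c) =
        noPair q∈ (P4-end c∈ d∈ b∈ q∈ cd (arc d→b) bq (≢-sym q≢c)) d→b
        where d→b = P4-end a∈ b∈ c∈ d∈ ab bc cd a≢d

    -- Two consecutive arcs start at any vertex of `C`, and without paths on four vertices both are
    -- sole.
    noSolePair⇒empty : x ∉ C
    noSolePair⇒empty x∈ = let
      _ , y∈ , xy = closed x∈
      _ , z∈ , yz = closed y∈
      in noPair x∈ (P4free⇒sole closed p4free x∈ y∈ xy) (P4free⇒sole closed p4free y∈ z∈ yz)

  -- S is the deficient set of Hall's theorem; W contains all other out-neighbours of
  -- v and of S, and deficiency is what makes it small.
  record Violator (v : Fin n) : Set where
    field
      S W      : Subset n
      S⊆N      : S ⊆ N v
      disjoint : x ∈ S → x ∉ W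
      covers   : v ⟶ x → x ∈ S ⊎ x ∈ W
      closed   : x ∈ S → x ⟶ y → y ∈ S ⊎ y ∈ W
      small    : ∣ W ∣ < ∣ N v ∣

    nonempty : ∃ λ x → x ∈ S
    nonempty with nonempty? S
    ... | yes x  = x
    ... | no ¬S = contradiction (p⊆q⇒∣p∣≤∣q∣ N⊆W) (<⇒≱ small)
      where
      N⊆W : N v ⊆ W
      N⊆W x∈ with covers x∈
      ... | inj₁ x∈S = contradiction (_ , x∈S) ¬S
      ... | inj₂ x∈W = x∈W

    ∣N∣≤ : x ∈ S → ∣ N x ∣ ≤ ∣ N x ∩ S ∣ + ∣ N x ∩ W ∣
    ∣N∣≤ {x} x∈S = ∣r∣≤∣r∩p∣+∣r∩q∣ (N x) S W (closed x∈S)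

    -- Otherwise the out-neighbours of x form a proper subset of S ⊆ N v.
    out-W : ∣ N v ∣ ≤ ∣ N x ∣ → x ∈ S → ∃ λ w → w ∈ W × x ⟶ w
    out-W {x} le x∈S with any? (λ w → (w ∈? W) ×-dec (w ∈? N x))
    ... | yes w  = w
    ... | no none = contradiction le (<⇒≱ (≤-trans
        (p⊂q⇒∣p∣<∣q∣ (N⊆S , x , x∈S , λ xx → ⟶⇒≢ xx refl)) (p⊆q⇒∣p∣≤∣q∣ S⊆N)))
      where
      N⊆S : N x ⊆ S
      N⊆S xy with closed x∈S xy
      ... | inj₁ y∈S = y∈S
      ... | inj₂ y∈W = contradiction (_ , y∈W , xy) none

  record SolePair {v} (V : Violator v) (x y z : Fin n) : Set where
    constructor solePair
    open Violator V
    field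
      source : x ∈ S
      first  : SoleOut S x y
      second : SoleOut S y z

  -- Violators at vertices of minimum out-degree

  module MinimumDegree (δ : ℕ) (δ≤∣N∣ : ∀ v → δ ≤ ∣ N v ∣) (violator : ∀ v → Violator v) where

    open Violator

    Minimal : Fin n → Set
    Minimal v = ∣ N v ∣ ≡ δ

    minimal-≤ : Minimal x → ∣ N x ∣ ≤ ∣ N y ∣
    minimal-≤ {y = y} min = ≤-trans (≤-reflexive min) (δ≤∣N∣ y)

    module _ {v} (min : Minimal v) (V : Violator v) where

      ∣W∣<δ : ∣ W V ∣ < δ
      ∣W∣<δ = subst (∣ W V ∣ <_) min (small V)

      -- Otherwise all out-neighbours of `x` lie in `W V`, which has fewer than `δ` elements.
      out-S : Closed (S V)
      out-S {x} x∈S with any? (λ y → (y ∈? S V) ×-dec (y ∈? N x))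
      ... | yes y  = y
      ... | no none = contradiction (δ≤∣N∣ x)
          (<⇒≱ (≤-trans (s≤s (p⊆q⇒∣p∣≤∣q∣ N⊆W)) ∣W∣<δ))
        where
        N⊆W : N x ⊆ W V
        N⊆W xy with closed V x∈S xy
        ... | inj₁ y∈S = contradiction (_ , y∈S , xy) none
        ... | inj₂ y∈W = y∈W

      -- Here δ ≤ |N x| ≤ 1 + |N x ∩ W| ≤ 1 + |W| ≤ δ, so equality holds throughout: `x` is minimal,
      -- and it dominates all δ - 1 vertices of `W V`.
      module _ (x∈S : x ∈ S V) (sole : SoleOut (S V) x y) where

        private
          ∣N∣≤1+ : ∣ N x ∣ ≤ suc ∣ N x ∩ W V ∣
          ∣N∣≤1+ = ≤-trans (∣N∣≤ V x∈S) (+-monoˡ-≤ _ (≤-trans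
            (p⊆q⇒∣p∣≤∣q∣ {q = ⁅ y ⁆} λ z∈ → let xz , z∈S = x∈p∩q⁻ (N x) (S V) z∈ in
              subst (_∈ ⁅ y ⁆) (sym (only sole z∈S xz)) (x∈⁅x⁆ y))
            (≤-reflexive (∣⁅x⁆∣≡1 y))))

        sole⇒minimal : Minimal x
        sole⇒minimal = ≤-antisym
          (≤-trans ∣N∣≤1+ (≤-trans (s≤s (∣p∩q∣≤∣q∣ (N x) (W V))) ∣W∣<δ)) (δ≤∣N∣ x)

        sole⇒δ≤1+∣W∣ : δ ≤ suc ∣ W V ∣
        sole⇒δ≤1+∣W∣ = ≤-trans (δ≤∣N∣ x) (≤-trans ∣N∣≤1+ (s≤s (∣p∩q∣≤∣q∣ (N x) (W V))))

        sole⇒W : z ∈ W V → x ⟶ z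
        sole⇒W {z} z∈W with z ∈? N x
        ... | yes xz = xz
        ... | no ¬xz = contradiction (≤-trans (δ≤∣N∣ x) (≤-trans ∣N∣≤1+
            (p⊂q⇒∣p∣<∣q∣ (p∩q⊆q (N x) (W V) , z , z∈W , ¬xz ∘ p∩q⊆p (N x) (W V))))) (<⇒≱ ∣W∣<δ)

        sole⇒N : x ⟶ z → z ≡ y ⊎ z ∈ W V
        sole⇒N xz with closed V x∈S xz
        ... | inj₁ z∈S = inj₁ (only sole z∈S xz)
        ... | inj₂ z∈W = inj₂ z∈W

    -- A sole pair s → s′ → s″ at a minimum-degree vertex makes s a minimum-degree
    -- vertex too, and the violator of s contains a sole pair again.
    module Descent {v s s′ s″} (min : Minimal v) (V : Violator v)
                   (pair : SolePair V s s′ s″) where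

      open SolePair pair

      V₁ : Violator s
      V₁ = violator s

      min₁ : Minimal s
      min₁ = sole⇒minimal min V source first

      -- This is `S V₁` without `s′`, because `N s` consists of `s′` and `W V`.
      C : Subset n
      C = S V₁ ∩ W V

      s′→W : z ∈ W V → s′ ⟶ z
      s′→W = sole⇒W min V (target first) second

      -- `s′` dominates `W V`, so no vertex of `C` has an arc back to `s′`, and its out-neighbours
      -- in `S V₁` lie in `C`.
      C-closed : Closed C
      C-closed x∈C with x∈p∩q⁻ (S V₁) (W V) x∈C
      ... | x∈S₁ , x∈W with out-S min₁ V₁ x∈S₁
      ...   | y , y∈S₁ , xy with sole⇒N min V source first (S⊆N V₁ y∈S₁)
      ...     | inj₁ refl = contradiction xy (asym (s′→W x∈W))
      ...     | inj₂ y∈W  = y , x∈p∩q⁺ (y∈S₁ , y∈W) , xy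

      C-nonempty : ∃ λ x → x ∈ C
      C-nonempty with nonempty V₁
      ... | x , x∈S₁ with sole⇒N min V source first (S⊆N V₁ x∈S₁)
      ...   | inj₂ x∈W = x , x∈p∩q⁺ (x∈S₁ , x∈W)
      ...   | inj₁ refl with out-S min₁ V₁ x∈S₁
      ...     | y , y∈S₁ , s′y with sole⇒N min V source first (S⊆N V₁ y∈S₁)
      ...       | inj₁ refl = contradiction s′y λ e → ⟶⇒≢ e refl
      ...       | inj₂ y∈W  = y , x∈p∩q⁺ (y∈S₁ , y∈W)

      sole-S₁ : x ∈ W V → SoleOut C x y → SoleOut (S V₁) x y
      sole-S₁ {x} {y} x∈W (soleOut y∈C xy only′) =
        soleOut (p∩q⊆p (S V₁) (W V) y∈C) xy only″
        where
        only″ : ∀ {o} → o ∈ S V₁ → x ⟶ o → o ≡ y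
        only″ o∈S₁ xo with sole⇒N min V source first (S⊆N V₁ o∈S₁)
        ... | inj₁ refl = contradiction xo (asym (s′→W x∈W))
        ... | inj₂ o∈W  = only′ (x∈p∩q⁺ (o∈S₁ , o∈W)) xo

      -- The new pair lies inside `W V`, whereas `s′` and `s″` fall on different sides of `V₁`.
      record Next : Set where
        field
          {t t′ t″} : Fin n
          next      : SolePair V₁ t t′ t″
          t∈W       : t ∈ W V
          t′∈W      : t′ ∈ W V
          t″∈W      : t″ ∈ W V
          s′∈S₁     : s′ ∈ S V₁
          s″∈W₁     : s″ ∈ W V₁

      -- Without a sole pair, `C` would be empty. Refuting `NoSolePair` yields a double negation
      -- only, which suffices for deriving contradictions.
      descend : P5free C → ¬ ¬ Next
      descend free ¬next = noSolePair⇒empty C-closed free noPair (proj₂ C-nonempty)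
        where
        noPair : NoSolePair C
        noPair {x} {y} {z} x∈C xy yz = ¬next record
          { next = solePair x∈S₁ (sole-S₁ x∈W xy) (sole-S₁ y∈W yz)
          ; t∈W = x∈W ; t′∈W = y∈W ; t″∈W = p∩q⊆q (S V₁) (W V) (target yz)
          ; s′∈S₁ = s′∈S₁ ; s″∈W₁ = s″∈W₁ }
          where
          x∈S₁ = p∩q⊆p (S V₁) (W V) x∈C
          x∈W = p∩q⊆q (S V₁) (W V) x∈C
          y∈W = p∩q⊆q (S V₁) (W V) (target xy)
          s′∈S₁ : s′ ∈ S V₁
          s′∈S₁ with covers V₁ (arc first)
          ... | inj₁ s′∈S₁ = s′∈S₁
          -- Having a sole out-neighbour in `S V₁`, `x` dominates `W V₁` and would send an arc to
          -- `s′`.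
          ... | inj₂ s′∈W₁ = contradiction (s′→W x∈W)
            (asym (sole⇒W min₁ V₁ x∈S₁ (sole-S₁ x∈W xy) s′∈W₁))
          s″∈W₁ : s″ ∈ W V₁
          s″∈W₁ with closed V₁ s′∈S₁ (arc second)
          ... | inj₂ s″∈W₁ = s″∈W₁
          -- `s″` is outside `N s`, since `s′` is the only out-neighbour of `s` in `S V`.
          ... | inj₁ s″∈S₁ with sole⇒N min V source first (S⊆N V₁ s″∈S₁)
          ...   | inj₁ refl = contradiction refl (⟶⇒≢ (arc second))
          ...   | inj₂ s″∈W = contradiction s″∈W (disjoint V (target second))

    -- The case without paths on five vertices

    module _ (free : ∀ {v} → Minimal v → P5free (N v)) where

      P5free⇒¬minimal : ∀ {v} → ¬ Minimal v
      P5free⇒¬minimal {v} min =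
        noSolePair⇒empty (out-S min V) (P5free-⊆ (S⊆N V) (free min)) noPair (proj₂ (nonempty V))
        where
        V = violator v
        noPair : NoSolePair (S V)
        noPair {s} {s′} {s″} s∈ ss′ s′s″ = descend (P5free-⊆ C⊆N (free min₁)) finish
          where
          open Descent min V (solePair s∈ ss′ s′s″)
          C⊆N : C ⊆ N s
          C⊆N x∈C = S⊆N V₁ (p∩q⊆p (S V₁) (W V) x∈C)
          W⊆N : W V ⊆ N s
          W⊆N = sole⇒W min V s∈ ss′
          -- `s′` dominates `W V`, and both lie in `N s`; putting `s′` in front of a path on four
          -- vertices gives one on five.
          W-free : P4free (W V)
          W-free a∈ b∈ c∈ d∈ ab bc cd a≢d = free min₁
            (arc ss′) (W⊆N a∈) (W⊆N b∈) (W⊆N c∈) (W⊆N d∈) (s′→W a∈) ab bc cd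
            (s′≢ c∈) a≢d (s′≢ d∈)
            where
            s′≢ : x ∈ W V → s′ ≢ x
            s′≢ x∈W refl = disjoint V (target ss′) x∈W
          C-free : P4free C
          C-free a∈ b∈ c∈ d∈ = W-free (p∩q⊆q (S V₁) (W V) a∈) (p∩q⊆q (S V₁) (W V) b∈)
            (p∩q⊆q (S V₁) (W V) c∈) (p∩q⊆q (S V₁) (W V) d∈)
          finish : ¬ Next
          finish record { t = t ; t′ = t′ ; t″ = t″ ; next = solePair t∈S₁ tt′ t′t″
                        ; t∈W = t∈W ; t′∈W = t′∈W ; t″∈W = t″∈W ; s″∈W₁ = s″∈W₁ }
            with out-W V (minimal-≤ min) (target s′s″)
          ... | w , w∈W , s″w with covers V₁ (W⊆N w∈W)
          -- As `C` has no path on four vertices, `w` has a sole out-neighbour and so dominates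
          -- `W V₁`, which contains `s″`.
          ...   | inj₁ w∈S₁ = asym s″w (sole⇒W min₁ V₁ w∈S₁ (sole-S₁ w∈W w→) s″∈W₁)
            where
            w∈C = x∈p∩q⁺ (w∈S₁ , w∈W)
            w→ = let _ , q∈ , wq = C-closed w∈C in P4free⇒sole C-closed C-free w∈C q∈ wq
          -- `t″` must lead back to `t`. Since `t` dominates `W V₁`, t′ → t″ → t → w is then a path
          -- on four vertices in `W V`.
          ...   | inj₂ w∈W₁ with C-closed (x∈p∩q⁺ (target t′t″ , t″∈W))
          ...     | o , o∈C , t″o with t ≟ o
          ...       | no t≢o   = C-free (x∈p∩q⁺ (t∈S₁ , t∈W)) (x∈p∩q⁺ (target tt′ , t′∈W))
            (x∈p∩q⁺ (target t′t″ , t″∈W)) o∈C (arc tt′) (arc t′t″) t″o t≢o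
          ...       | yes refl = W-free t′∈W t″∈W t∈W w∈W (arc t′t″) t″o
            (sole⇒W min₁ V₁ t∈S₁ tt′ w∈W₁) λ where refl → disjoint V₁ (target tt′) w∈W₁

    -- Minimum out-degree five

    module DegreeFive (δ≡5 : δ ≡ 5) where

      5≤∣N∣ : ∀ x → 5 ≤ ∣ N x ∣
      5≤∣N∣ x = subst (_≤ ∣ N x ∣) δ≡5 (δ≤∣N∣ x)

      ∣S∣≤5 : ∀ {v} → Minimal v → (V : Violator v) → ∣ S V ∣ ≤ 5
      ∣S∣≤5 min V = ≤-trans (p⊆q⇒∣p∣≤∣q∣ (S⊆N V)) (≤-reflexive (trans min δ≡5))

      ∣W∣≤4 : ∀ {v} → Minimal v → (V : Violator v) → ∣ W V ∣ ≤ 4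
      ∣W∣≤4 min V = ≤-pred (subst (∣ W V ∣ <_) δ≡5 (∣W∣<δ min V))

      -- An out-neighbour o missed by s″ would leave it at most 2 out-neighbours in S and,
      -- as t and t′ dominate s″, at most 2 in W.
      s″-dominates : ∀ {v s s′ s″ o} (min : Minimal v) (V : Violator v)
        (pair : SolePair V s s′ s″) → Descent.Next min V pair →
        o ∈ S V → o ≢ s′ → o ≢ s″ → s″ ⟶ o
      s″-dominates {s′ = s′} {s″} {o} min V pair next o∈S o≢s′ o≢s″ with o ∈? N s″
      ... | yes s″o = s″o
      ... | no ¬s″o = contradiction (begin
          10                                          ≤⟨ +-monoʳ-≤ 5 (5≤∣N∣ s″) ⟩
          5 + ∣ N s″ ∣                                 ≤⟨ +-monoʳ-≤ 5 (∣N∣≤ V (target second)) ⟩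
          5 + (∣ N s″ ∩ S V ∣ + ∣ N s″ ∩ W V ∣)         ≡⟨ regroup ∣ N s″ ∩ S V ∣ _ ⟩
          (3 + ∣ N s″ ∩ S V ∣) + (2 + ∣ N s″ ∩ W V ∣)   ≤⟨ +-mono-≤ in-S in-W ⟩
          ∣ S V ∣ + ∣ W V ∣                             ≤⟨ +-mono-≤ (∣S∣≤5 min V) (∣W∣≤4 min V) ⟩
          9                                           ∎) (from-no (10 ≤? 9))
        where
        open ≤-Reasoning
        open SolePair pair
        open Descent min V pair
        open Next next using (t∈W; t′∈W; s″∈W₁) renaming (next to pair₁)
        open SolePair pair₁ using () renaming (source to t∈S₁; first to tt′; second to t′t″)
        regroup : ∀ a b → 5 + (a + b) ≡ (3 + a) + (2 + b)
        regroup = solve-∀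
        in-S : 3 + ∣ N s″ ∩ S V ∣ ≤ ∣ S V ∣
        in-S = length+∣q∣≤∣p∣ (s′ ∷ s″ ∷ o ∷ [])
          ((⟶⇒≢ (arc second) ∷ ≢-sym o≢s′ ∷ []) ∷ (≢-sym o≢s″ ∷ []) ∷ [] ∷ [])
          (target first ∷ target second ∷ o∈S ∷ [])
          (p∩q⊆q (N s″) (S V))
          (asym (arc second) ∘ p∩q⊆p (N s″) (S V) ∷ (λ e → ⟶⇒≢ (p∩q⊆p (N s″) (S V) e) refl) ∷
           ¬s″o ∘ p∩q⊆p (N s″) (S V) ∷ [])
        in-W : 2 + ∣ N s″ ∩ W V ∣ ≤ ∣ W V ∣
        in-W = length+∣q∣≤∣p∣ _
          ((⟶⇒≢ (arc tt′) ∷ []) ∷ [] ∷ []) (t∈W ∷ t′∈W ∷ [])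
          (p∩q⊆q (N s″) (W V))
          (asym (sole⇒W min₁ V₁ t∈S₁ tt′ s″∈W₁) ∘ p∩q⊆p (N s″) (W V) ∷
           asym (sole⇒W min₁ V₁ (target tt′) t′t″ s″∈W₁) ∘ p∩q⊆p (N s″) (W V) ∷ [])

      -- A second descent, from the pair t → t′ → t″ in `W V`, shows that t″ dominates the rest of
      -- `S V₁`, including `s′`; but `s′` dominates `W V`.
      noSolePair : ∀ {v} → Minimal v → (V : Violator v) → NoSolePair (S V)
      noSolePair min V {s} {s′} {s″} s∈S ss′ s′s″ =
        descend (∣C∣≤4⇒P5free (≤-trans (∣p∩q∣≤∣q∣ (S V₁) (W V)) (∣W∣≤4 min V))) again
        where
        open Descent min V (solePair s∈S ss′ s′s″)
        again : ¬ Next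
        again record { next = pair₁ ; t′∈W = t′∈W ; t″∈W = t″∈W ; s′∈S₁ = s′∈S₁ } =
          D₁.descend (∣C∣≤4⇒P5free (≤-trans (∣p∩q∣≤∣q∣ (S D₁.V₁) (W V₁)) (∣W∣≤4 min₁ V₁)))
            λ next₁ → asym (s′→W t″∈W) (s″-dominates min₁ V₁ pair₁ next₁ s′∈S₁
              (λ where refl → disjoint V (target ss′) t′∈W)
              (λ where refl → disjoint V (target ss′) t″∈W))
          where module D₁ = Descent min₁ V₁ pair₁

      module _ {v} (min : Minimal v) (V : Violator v) where

        -- At most four vertices carry no path on five, so without sole pairs `S V` would be empty.
        ∣S∣≡5 : ∣ S V ∣ ≡ 5
        ∣S∣≡5 with 5 ≤? ∣ S V ∣
        ... | yes 5≤ = ≤-antisym (∣S∣≤5 min V) 5≤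
        ... | no ≱5  = contradiction (proj₂ (nonempty V)) (noSolePair⇒empty (out-S min V)
          (∣C∣≤4⇒P5free (≤-pred (≰⇒> ≱5))) (noSolePair min V))

        N⊆S : N v ⊆ S V
        N⊆S {x} vx with x ∈? S V
        ... | yes x∈S = x∈S
        ... | no x∉S  = contradiction (≤-reflexive (trans (trans min δ≡5) (sym ∣S∣≡5)))
          (<⇒≱ (p⊂q⇒∣p∣<∣q∣ (S⊆N V , x , vx , x∉S)))

      -- The out-neighbours p and q of s′ send 5 arcs to W. With them, the out-degrees
      -- inside S V₁ add up to 11, but there are only 10 pairs of vertices.
      noSole : ∀ {v} (min : Minimal v) (V : Violator v) → x ∈ S V → ¬ SoleOut (S V) x y
      noSole {s} {s′} min V s∈S ss′ with out-S min V (target ss′)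
      ... | p , p∈S , s′p with soleOrOther (S V) p∈S s′p
      ...   | inj₁ s′-sole = noSolePair min V s∈S ss′ s′-sole
      ...   | inj₂ (q , q∈S , s′q , q≢p) = contradiction 27≤25 (from-no (27 ≤? 25))
        where
        open ≤-Reasoning
        s′∈S = target ss′
        min₁ = sole⇒minimal min V s∈S ss′
        V₁ = violator s
        s′∈S₁ = N⊆S min₁ V₁ (arc ss′)
        W⊆S₁ : W V ⊆ S V₁
        W⊆S₁ w∈W = N⊆S min₁ V₁ (sole⇒W min V s∈S ss′ w∈W)

        -- Such an `o` is an element of `S V` other than `s′`, hence outside `N s` and outside
        -- `S V₁`.
        in-W₁ : ∀ {o} → o ∈ S V → s′ ⟶ o → o ∈ W V₁
        in-W₁ o∈S s′o with closed V₁ s′∈S₁ s′o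
        ... | inj₂ o∈W₁ = o∈W₁
        ... | inj₁ o∈S₁ with sole⇒N min V s∈S ss′ (S⊆N V₁ o∈S₁)
        ...   | inj₁ refl = contradiction refl (⟶⇒≢ s′o)
        ...   | inj₂ o∈W = contradiction o∈W (disjoint V o∈S)

        out≤3 : ∀ {x y} → x ∈ S V → y ∈ S V → x ⟶ y → ∣ N y ∩ S V ∣ ≤ 3
        out≤3 {x} {y} x∈S y∈S xy = +-cancelˡ-≤ 2 _ 3 (≤-trans
          (length+∣q∣≤∣p∣ (x ∷ y ∷ []) ((⟶⇒≢ xy ∷ []) ∷ [] ∷ []) (x∈S ∷ y∈S ∷ [])
            (p∩q⊆q (N y) (S V))
            (asym xy ∘ p∩q⊆p (N y) (S V) ∷ (λ e → ⟶⇒≢ (p∩q⊆p (N y) (S V) e) refl) ∷ []))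
          (∣S∣≤5 min V))

        out≤2 : ∀ {x y z} → x ∈ S V → y ∈ S V → z ∈ S V → x ⟶ y → x ⟶ z → y ≢ z →
                ¬ y ⟶ z → ∣ N y ∩ S V ∣ ≤ 2
        out≤2 {x} {y} {z} x∈S y∈S z∈S xy xz y≢z ¬yz = +-cancelˡ-≤ 3 _ 2 (≤-trans
          (length+∣q∣≤∣p∣ (x ∷ y ∷ z ∷ [])
            ((⟶⇒≢ xy ∷ ⟶⇒≢ xz ∷ []) ∷ (y≢z ∷ []) ∷ [] ∷ []) (x∈S ∷ y∈S ∷ z∈S ∷ [])
            (p∩q⊆q (N y) (S V))
            (asym xy ∘ p∩q⊆p (N y) (S V) ∷ (λ e → ⟶⇒≢ (p∩q⊆p (N y) (S V) e) refl) ∷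
             ¬yz ∘ p∩q⊆p (N y) (S V) ∷ []))
          (∣S∣≤5 min V))

        -- Neither `p` nor `q` has an arc back to `s′`, and at most one of them has an arc to the
        -- other.
        out-pq : ∣ N p ∩ S V ∣ + ∣ N q ∩ S V ∣ ≤ 5
        out-pq with q ∈? N p
        ... | no ¬pq = +-mono-≤ (out≤2 s′∈S p∈S q∈S s′p s′q (≢-sym q≢p) ¬pq)
                                (out≤3 s′∈S q∈S s′q)
        ... | yes pq = +-mono-≤ (out≤3 s′∈S p∈S s′p)
                                (out≤2 s′∈S q∈S p∈S s′q s′p q≢p (asym pq))

        5≤hits : 5 ≤ ∣ N p ∩ W V ∣ + ∣ N q ∩ W V ∣
        5≤hits = k+m≤a+b∧a≤k⇒m≤b 5 5 (begin
          10                                              ≤⟨ +-mono-≤ (5≤∣N∣ p) (5≤∣N∣ q) ⟩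
          ∣ N p ∣ + ∣ N q ∣                                 ≤⟨ +-mono-≤ (∣N∣≤ V p∈S) (∣N∣≤ V q∈S) ⟩
          (∣ N p ∩ S V ∣ + ∣ N p ∩ W V ∣) + (∣ N q ∩ S V ∣ + ∣ N q ∩ W V ∣)
            ≡⟨ regroup (∣ N p ∩ S V ∣) (∣ N p ∩ W V ∣) (∣ N q ∩ S V ∣) _ ⟩
          (∣ N p ∩ S V ∣ + ∣ N q ∩ S V ∣) + (∣ N p ∩ W V ∣ + ∣ N q ∩ W V ∣) ∎) out-pq
          where
          regroup : ∀ a b c d → (a + b) + (c + d) ≡ (a + c) + (b + d)
          regroup = solve-∀

        hits : Fin n → ℕ
        hits x = χ (N p ∩ W V) x + χ (N q ∩ W V) x

        -- Lower bounds for out-degrees inside `S V₁`. A vertex of `W V` has at least 5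
        -- out-neighbours, of which at most 4 lie in `W V₁`, and one fewer for each of `p` and `q`
        -- that hits it. For `s′` the bound is 2.
        g : Fin n → ℕ
        g x = χ (W V) x + hits x + χ ⁅ s′ ⁆ x * 2

        hits-missed : ∀ x → hits x + ∣ N x ∩ W V₁ ∣ ≤ ∣ W V₁ ∣
        hits-missed x with x ∈? N p ∩ W V | x ∈? N q ∩ W V
        ... | no ¬p | no ¬q rewrite χ-∉ ¬p | χ-∉ ¬q = ∣p∩q∣≤∣q∣ (N x) (W V₁)
        ... | yes px | no ¬q rewrite χ-∈ px | χ-∉ ¬q = length+∣q∣≤∣p∣ (p ∷ [])
          ([] ∷ []) (in-W₁ p∈S s′p ∷ []) (p∩q⊆q (N x) (W V₁))
          (asym (p∩q⊆p (N p) (W V) px) ∘ p∩q⊆p (N x) (W V₁) ∷ [])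
        ... | no ¬p | yes qx rewrite χ-∉ ¬p | χ-∈ qx = length+∣q∣≤∣p∣ (q ∷ [])
          ([] ∷ []) (in-W₁ q∈S s′q ∷ []) (p∩q⊆q (N x) (W V₁))
          (asym (p∩q⊆p (N q) (W V) qx) ∘ p∩q⊆p (N x) (W V₁) ∷ [])
        ... | yes px | yes qx rewrite χ-∈ px | χ-∈ qx = length+∣q∣≤∣p∣ (q ∷ p ∷ [])
          ((q≢p ∷ []) ∷ [] ∷ []) (in-W₁ q∈S s′q ∷ in-W₁ p∈S s′p ∷ []) (p∩q⊆q (N x) (W V₁))
          (asym (p∩q⊆p (N q) (W V) qx) ∘ p∩q⊆p (N x) (W V₁) ∷
           asym (p∩q⊆p (N p) (W V) px) ∘ p∩q⊆p (N x) (W V₁) ∷ [])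

        g-W : ∀ {x} → x ∈ W V → suc (hits x) ≤ ∣ N x ∩ S V₁ ∣
        g-W {x} x∈W = k+m≤a+b∧b≤m⇒k≤a (suc (hits x)) ∣ N x ∩ W V₁ ∣ (begin
          suc (hits x + ∣ N x ∩ W V₁ ∣)        ≤⟨ s≤s (hits-missed x) ⟩
          suc ∣ W V₁ ∣                         ≤⟨ s≤s (∣W∣≤4 min₁ V₁) ⟩
          5                                   ≤⟨ 5≤∣N∣ x ⟩
          ∣ N x ∣                              ≤⟨ ∣N∣≤ V₁ (W⊆S₁ x∈W) ⟩
          ∣ N x ∩ S V₁ ∣ + ∣ N x ∩ W V₁ ∣       ∎) ≤-refl

        -- At most 3 of the at least 5 out-neighbours of `s′` lie in `S V`; the others lie in `W V`,
        -- a subset of `S V₁`.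
        g-s′ : 2 ≤ ∣ N s′ ∩ S V₁ ∣
        g-s′ = ≤-trans (k+m≤a+b∧a≤k⇒m≤b 3 2 (≤-trans (5≤∣N∣ s′) (∣N∣≤ V s′∈S))
                                               (out≤3 s∈S s′∈S (arc ss′)))
          (p⊆q⇒∣p∣≤∣q∣ λ w∈ → let s′w , w∈W = x∈p∩q⁻ (N s′) (W V) w∈ in x∈p∩q⁺ (s′w , W⊆S₁ w∈W))

        g≤ : ∀ x → g x ≤ χ (S V₁) x * ∣ N x ∩ S V₁ ∣
        g≤ x with x ∈? W V | x ≟ s′
        ... | yes x∈W | _ rewrite χ-∈ x∈W | χ-∈ (W⊆S₁ x∈W) | +-identityʳ ∣ N x ∩ S V₁ ∣
                                | χ-∉ {x = x} {p = ⁅ s′ ⁆} (λ x∈ → disjoint V s′∈S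
                                    (subst (_∈ W V) (x∈⁅y⁆⇒x≡y s′ x∈) x∈W))
                                | +-identityʳ (hits x) = g-W x∈W
        ... | no x∉W | yes refl rewrite χ-∉ x∉W | χ-∉ (x∉W ∘ p∩q⊆q (N p) (W V))
                                      | χ-∉ (x∉W ∘ p∩q⊆q (N q) (W V)) | χ-∈ (x∈⁅x⁆ s′)
                                      | χ-∈ s′∈S₁ | +-identityʳ ∣ N s′ ∩ S V₁ ∣ = g-s′
        ... | no x∉W | no x≢s′ rewrite χ-∉ x∉W | χ-∉ (x∉W ∘ p∩q⊆q (N p) (W V))
                                      | χ-∉ (x∉W ∘ p∩q⊆q (N q) (W V))
                                      | χ-∉ (x≢s′ ∘ x∈⁅y⁆⇒x≡y {x = x} s′) = z≤n

        11≤sum-g : 11 ≤ sum g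
        11≤sum-g = begin
          -- 4 counts the vertices of `W V`, 5 the hits from `p` and `q`, and 2 comes from `s′`.
          4 + 5 + 2
            ≤⟨ +-monoˡ-≤ 2 (+-mono-≤
                 (≤-pred (subst (_≤ _) δ≡5 (sole⇒δ≤1+∣W∣ min V s∈S ss′))) 5≤hits) ⟩
          ∣ W V ∣ + (∣ N p ∩ W V ∣ + ∣ N q ∩ W V ∣) + 1 * 2
            ≡⟨ sym (cong₂ _+_ (cong₂ _+_ (sum-χ (W V))
                 (trans (∑-distrib-+ (χ (N p ∩ W V)) _)
                        (cong₂ _+_ (sum-χ (N p ∩ W V)) (sum-χ (N q ∩ W V)))))
                 (cong (_* 2) (trans (sum-χ ⁅ s′ ⁆) (∣⁅x⁆∣≡1 s′)))) ⟩
          sum (χ (W V)) + sum hits + sum (χ ⁅ s′ ⁆) * 2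
            ≡⟨ cong₂ _+_ (sym (∑-distrib-+ (χ (W V)) hits)) (*-distribʳ-sum 2 (χ ⁅ s′ ⁆)) ⟩
          sum (λ x → χ (W V) x + hits x) + sum (λ x → χ ⁅ s′ ⁆ x * 2)
            ≡⟨ sym (∑-distrib-+ (λ x → χ (W V) x + hits x) _) ⟩
          sum g ∎

        27≤25 : 27 ≤ 25
        27≤25 = ≤-trans (+-monoˡ-≤ 5 (+-mono-≤ 11≤sum-g 11≤sum-g))
          (subst (λ c → sum g + sum g + c ≤ c * c) (∣S∣≡5 min₁ V₁)
                 (arcs-inside N asym (S V₁) g g≤))

      module _ {v} (min : Minimal v) (V : Violator v) where

        otherOut : x ∈ S V → y ∈ S V → x ⟶ y → ∃ λ o → o ∈ S V × x ⟶ o × o ≢ y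
        otherOut x∈S y∈S xy with soleOrOther (S V) y∈S xy
        ... | inj₁ sole  = contradiction sole (noSole min V x∈S)
        ... | inj₂ other = other

        2≤out : x ∈ S V → 2 ≤ ∣ N x ∩ S V ∣
        2≤out x∈S with out-S min V x∈S
        ... | y , y∈S , xy with otherOut x∈S y∈S xy
        ...   | o , o∈S , xo , o≢y = length≤∣p∣ (o ∷ y ∷ []) ((o≢y ∷ []) ∷ [] ∷ [])
          (x∈p∩q⁺ (xo , o∈S) ∷ x∈p∩q⁺ (xy , y∈S) ∷ [])

        out≤2 : x ∈ S V → ∣ N x ∩ S V ∣ ≤ 2
        out≤2 = outdegree≤2 N asym (S V) (∣S∣≡5 min V) 2≤out

        3≤out-W : x ∈ S V → 3 ≤ ∣ N x ∩ W V ∣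
        3≤out-W {x} x∈S = k+m≤a+b∧a≤k⇒m≤b 2 3 (≤-trans (5≤∣N∣ x) (∣N∣≤ V x∈S)) (out≤2 x∈S)

        record Transitive (s s₁ s₂ : Fin n) : Set where
          field
            s₁∈S : s₁ ∈ S V
            s₂∈S : s₂ ∈ S V
            ss₁  : s ⟶ s₁
            ss₂  : s ⟶ s₂
            s₁s₂ : s₁ ⟶ s₂

        -- `S V` induces a tournament, so two out-neighbours of `s` in it are adjacent; they are
        -- named in the order of their arc.
        transitive : ∀ {s} → s ∈ S V → ∃ λ s₁ → ∃ λ s₂ → Transitive s s₁ s₂
        transitive s∈S with out-S min V s∈S
        ... | y , y∈S , sy with otherOut s∈S y∈S sy
        ...   | o , o∈S , so , o≢y
          with 5-vertex-tournament N asym (S V) (∣S∣≡5 min V) 2≤out o∈S y∈S o≢y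
        ...     | inj₁ oy = _ , _ , record
                  { s₁∈S = o∈S ; s₂∈S = y∈S ; ss₁ = so ; ss₂ = sy ; s₁s₂ = oy }
        ...     | inj₂ yo = _ , _ , record
                  { s₁∈S = y∈S ; s₂∈S = o∈S ; ss₁ = sy ; ss₂ = so ; s₁s₂ = yo }

      module _ {v} (min : Minimal v) (V : Violator v) where

        -- Inside S V₁ = N s, the vertex s₁ would have s₂ and two elements of W as
        -- out-neighbours.
        S⇒¬minimal : ∀ {s} → s ∈ S V → ¬ Minimal s
        S⇒¬minimal {s} s∈S min₁ with transitive min V s∈S
        ... | s₁ , s₂ , record { s₁∈S = s₁∈S ; s₂∈S = s₂∈S ; ss₁ = ss₁ ; ss₂ = ss₂ ; s₁s₂ = s₁s₂ } =
          contradiction (≤-trans (≤-trans (s≤s 2≤∣X∣) s₂∷X) (out≤2 min₁ V₁ (N⊆S min₁ V₁ ss₁)))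
                        (from-no (3 ≤? 2))
          where
          V₁ = violator s
          X = (N s₁ ∩ W V) ∩ (N s ∩ W V)
          -- Two sets of at least 3 elements among at most 4 share at least 3 + 3 - 4.
          2≤∣X∣ : 2 ≤ ∣ X ∣
          2≤∣X∣ = k+m≤a+b∧a≤k⇒m≤b 4 2 (≤-trans (+-mono-≤ (3≤out-W min V s₁∈S) (3≤out-W min V s∈S))
            (∣p∣+∣q∣≤∣r∣+∣p∩q∣ (N s₁ ∩ W V) (N s ∩ W V) (p∩q⊆q (N s₁) (W V)) (p∩q⊆q (N s) (W V))))
            (∣W∣≤4 min V)
          s₂∷X : 1 + ∣ X ∣ ≤ ∣ N s₁ ∩ S V₁ ∣
          s₂∷X = length+∣q∣≤∣p∣ (s₂ ∷ []) ([] ∷ [])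
            (x∈p∩q⁺ (s₁s₂ , N⊆S min₁ V₁ ss₂) ∷ [])
            (λ w∈ → let a , b = x∈p∩q⁻ (N s₁ ∩ W V) (N s ∩ W V) w∈ in
              x∈p∩q⁺ (p∩q⊆p (N s₁) (W V) a , N⊆S min₁ V₁ (p∩q⊆p (N s) (W V) b)))
            ((λ w∈ → disjoint V s₂∈S
              (p∩q⊆q (N s₁) (W V) (p∩q⊆p (N s₁ ∩ W V) (N s ∩ W V) w∈))) ∷ [])

        -- As `x` is not minimal, it has at least 6 out-neighbours, and at most 2 of them lie in
        -- `S V`.
        4≤out-W : x ∈ S V → 4 ≤ ∣ N x ∩ W V ∣
        4≤out-W {x} x∈S = k+m≤a+b∧a≤k⇒m≤b 2 4
          (≤-trans (subst (_< ∣ N x ∣) δ≡5 (≤∧≢⇒< (δ≤∣N∣ x) (S⇒¬minimal x∈S ∘ sym)))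
                   (∣N∣≤ V x∈S)) (out≤2 min V x∈S)

        S⇒W : x ∈ S V → y ∈ W V → x ⟶ y
        S⇒W {x} {y} x∈S y∈W with y ∈? N x
        ... | yes xy = xy
        ... | no ¬xy = contradiction (4≤out-W x∈S) (<⇒≱ (≤-trans
          (p⊂q⇒∣p∣<∣q∣ (p∩q⊆q (N x) (W V) , y , y∈W , ¬xy ∘ p∩q⊆p (N x) (W V))) (∣W∣≤4 min V)))

        -- Two vertices of S in W V₁ leave too little room there: every vertex of C would
        -- have two out-neighbours in C, which has at most 4 vertices.
        ¬two-in-W₁ : ∀ {s a b} → s ∈ S V → (V₁ : Violator s) →
                     a ∈ S V → b ∈ S V → a ≢ b → a ∈ W V₁ → b ∈ W V₁ → ⊥
        ¬two-in-W₁ {s} {a} {b} s∈S V₁ a∈S b∈S a≢b a∈W₁ b∈W₁ =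
          contradiction (≤-trans (outdegree-2⇒5≤∣C∣ N asym C (proj₂ C-nonempty) out-C)
            (≤-trans (∣p∩q∣≤∣q∣ (S V₁) (W V)) (∣W∣≤4 min V))) (from-no (5 ≤? 4))
          where
          open ≤-Reasoning
          C = S V₁ ∩ W V
          ∣W₁∣≤5 : ∣ W V₁ ∣ ≤ 5
          ∣W₁∣≤5 = ≤-pred (begin
            suc ∣ W V₁ ∣                    ≤⟨ small V₁ ⟩
            ∣ N s ∣                         ≤⟨ ∣N∣≤ V s∈S ⟩
            ∣ N s ∩ S V ∣ + ∣ N s ∩ W V ∣
              ≤⟨ +-mono-≤ (out≤2 min V s∈S) (≤-trans (∣p∩q∣≤∣q∣ (N s) (W V)) (∣W∣≤4 min V)) ⟩
            6                              ∎)
          ∣W₁─S∣≤3 : ∣ W V₁ ─ S V ∣ ≤ 3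
          ∣W₁─S∣≤3 = +-cancelˡ-≤ 2 _ 3 (≤-trans
            (length+∣q∣≤∣p∣ (a ∷ b ∷ []) ((a≢b ∷ []) ∷ [] ∷ []) (a∈W₁ ∷ b∈W₁ ∷ [])
              (p─q⊆p (W V₁) (S V))
              ((λ e → x∈p─q⇒x∉q (W V₁) (S V) e a∈S) ∷ (λ e → x∈p─q⇒x∉q (W V₁) (S V) e b∈S) ∷ []))
            ∣W₁∣≤5)
          C-nonempty : ∃ λ x → x ∈ C
          C-nonempty with nonempty? C
          ... | yes x = x
          -- Otherwise `W V`, with its 4 vertices dominated by `s`, would fit into `W V₁ ─ S V`.
          ... | no ¬C = contradiction
              (≤-trans (≤-trans (≤-trans (4≤out-W s∈S) (∣p∩q∣≤∣q∣ (N s) (W V)))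
                                (p⊆q⇒∣p∣≤∣q∣ W⊆)) ∣W₁─S∣≤3) (from-no (4 ≤? 3))
            where
            W⊆ : W V ⊆ W V₁ ─ S V
            W⊆ w∈W with covers V₁ (S⇒W s∈S w∈W)
            ... | inj₁ w∈S₁ = contradiction (_ , x∈p∩q⁺ (w∈S₁ , w∈W)) ¬C
            ... | inj₂ w∈W₁ = x∈p∧x∉q⇒x∈p─q w∈W₁ λ w∈S → disjoint V w∈S w∈W
          out-C : ∀ {x} → x ∈ C → 2 ≤ ∣ N x ∩ C ∣
          -- `x` lies in `W V`, which `S V` dominates, so it has no out-neighbour in `S V`. At most
          -- 3 of its at least 5 out-neighbours are outside `C`.
          out-C {x} x∈C = k+m≤a+b∧b≤m⇒k≤a 2 3
            (≤-trans (5≤∣N∣ x) (∣r∣≤∣r∩p∣+∣r∩q∣ (N x) C (W V₁ ─ S V) cover))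
            (≤-trans (∣p∩q∣≤∣q∣ (N x) (W V₁ ─ S V)) ∣W₁─S∣≤3)
            where
            x∈S₁ = p∩q⊆p (S V₁) (W V) x∈C
            ∉S : ∀ {y} → x ⟶ y → y ∉ S V
            ∉S xy y∈S = asym xy (S⇒W y∈S (p∩q⊆q (S V₁) (W V) x∈C))
            cover : ∀ {y} → x ⟶ y → y ∈ C ⊎ y ∈ W V₁ ─ S V
            cover xy with closed V₁ x∈S₁ xy
            ... | inj₂ y∈W₁ = inj₂ (x∈p∧x∉q⇒x∈p─q y∈W₁ (∉S xy))
            ... | inj₁ y∈S₁ with closed V s∈S (S⊆N V₁ y∈S₁)
            ...   | inj₁ y∈S = contradiction y∈S (∉S xy)
            ...   | inj₂ y∈W = inj₁ (x∈p∩q⁺ (y∈S₁ , y∈W))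

      -- An out-neighbour in `S V` of a vertex of `S V₁` is in `W V₁` unless it is `s₁` or `s₂`, the
      -- only out-neighbours of `s` in `S V`. Wherever `s₁` and `s₂` lie, this puts two vertices of
      -- `S V` into `W V₁`.
      ¬minimal : ∀ {v} → ¬ Minimal v
      ¬minimal {v} min with nonempty (violator v)
      ... | s , s∈S with transitive min (violator v) s∈S
      ...   | s₁ , s₂ , record { s₁∈S = s₁∈S ; s₂∈S = s₂∈S ; ss₁ = ss₁ ; ss₂ = ss₂ ; s₁s₂ = s₁s₂ } =
        cases (covers V₁ ss₁) (covers V₁ ss₂)
        where
        V  = violator v
        V₁ = violator s
        only-s₁s₂ : ∀ {o} → o ∈ S V → o ≢ s₁ → o ≢ s₂ → ¬ s ⟶ o
        only-s₁s₂ {o} o∈S o≢s₁ o≢s₂ so = contradiction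
          (≤-trans (length≤∣p∣ (o ∷ s₁ ∷ s₂ ∷ [])
            ((o≢s₁ ∷ o≢s₂ ∷ []) ∷ (⟶⇒≢ s₁s₂ ∷ []) ∷ [] ∷ [])
            (x∈p∩q⁺ (so , o∈S) ∷ x∈p∩q⁺ (ss₁ , s₁∈S) ∷ x∈p∩q⁺ (ss₂ , s₂∈S) ∷ []))
            (out≤2 min V s∈S)) (from-no (3 ≤? 2))
        in-W₁ : ∀ {x o} → x ∈ S V₁ → x ⟶ o → o ∈ S V → o ≢ s₁ → o ≢ s₂ → o ∈ W V₁
        in-W₁ x∈S₁ xo o∈S o≢s₁ o≢s₂ with closed V₁ x∈S₁ xo
        ... | inj₁ o∈S₁ = contradiction (S⊆N V₁ o∈S₁) (only-s₁s₂ o∈S o≢s₁ o≢s₂)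
        ... | inj₂ o∈W₁ = o∈W₁
        ≢s₁ : ∀ {o} → s₂ ⟶ o → o ≢ s₁
        ≢s₁ s₂o refl = asym s₁s₂ s₂o
        cases : s₁ ∈ S V₁ ⊎ s₁ ∈ W V₁ → s₂ ∈ S V₁ ⊎ s₂ ∈ W V₁ → ⊥
        cases (inj₂ s₁∈W₁) (inj₂ s₂∈W₁) =
          ¬two-in-W₁ min V s∈S V₁ s₁∈S s₂∈S (⟶⇒≢ s₁s₂) s₁∈W₁ s₂∈W₁
        cases (inj₁ s₁∈S₁) (inj₂ s₂∈W₁) with otherOut min V s₁∈S s₂∈S s₁s₂
        ... | o , o∈S , s₁o , o≢s₂ = ¬two-in-W₁ min V s∈S V₁ o∈S s₂∈S o≢s₂
          (in-W₁ s₁∈S₁ s₁o o∈S (≢-sym (⟶⇒≢ s₁o)) o≢s₂) s₂∈W₁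
        cases _ (inj₁ s₂∈S₁) with out-S min V s₂∈S
        ... | y , y∈S , s₂y with otherOut min V s₂∈S y∈S s₂y
        ...   | o , o∈S , s₂o , o≢y = ¬two-in-W₁ min V s∈S V₁ o∈S y∈S o≢y
          (in-W₁ s₂∈S₁ s₂o o∈S (≢s₁ s₂o) (≢-sym (⟶⇒≢ s₂o)))
          (in-W₁ s₂∈S₁ s₂y y∈S (≢s₁ s₂y) (≢-sym (⟶⇒≢ s₂y)))

-- Counts, minima and finite search

∣⟪⟫∣≡count : ∀ {m} {P : Pred (Fin n) 0ℓ} (P? : Decidable P) (f : Fin m → Fin n) →
            ∣ tabulate (does ∘ P? ∘ f) ∣ ≡ count P? (tabulate f)
∣⟪⟫∣≡count {m = zero}  P? f = refl
∣⟪⟫∣≡count {m = suc m} P? f with does (P? (f zero))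
... | true  = cong suc (∣⟪⟫∣≡count P? (f ∘ suc))
... | false = ∣⟪⟫∣≡count P? (f ∘ suc)

foldr₁-⊓-attained : ∀ {n} (f : Fin (suc n) → ℕ) →
  ∃ λ i → f i ≡ foldr₁ _⊓_ (tabulate f) × ∀ j → f i ≤ f j
foldr₁-⊓-attained {zero}  f = zero , refl , λ where zero → ≤-refl
foldr₁-⊓-attained {suc n} f with foldr₁-⊓-attained (f ∘ suc)
... | i , eq , least with ≤-total (f zero) (f (suc i))
...   | inj₁ le = zero , sym (trans (cong (f zero ⊓_) (sym eq)) (m≤n⇒m⊓n≡m le)) , λ where
  zero    → ≤-refl
  (suc j) → ≤-trans le (least j)
...   | inj₂ ge = suc i , sym (trans (cong (f zero ⊓_) (sym eq)) (m≥n⇒m⊓n≡n ge)) , λ where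
  zero    → ge
  (suc j) → least j

∃⊎∀ : ∀ {n a b} {A : Fin n → Set a} {B : Fin n → Set b} →
      (∀ i → A i ⊎ B i) → ∃ A ⊎ ∀ i → B i
∃⊎∀ {zero}  _  = inj₂ λ ()
∃⊎∀ {suc n} ab with ab zero | ∃⊎∀ (ab ∘ suc)
... | inj₁ a | _            = inj₁ (zero , a)
... | inj₂ _ | inj₁ (i , a) = inj₁ (suc i , a)
... | inj₂ b | inj₂ bs      = inj₂ λ where
  zero    → b
  (suc i) → bs i

-- Matchings, violators and paths in a digraph

module _ {n : ℕ} (D : Digraph n) (oriented : Digraph.Oriented D) where

  open Digraph D

  N : Fin n → Subset n
  N v = ⟪ arc? v ⟫

  arc⁺ : Arc x y → y ∈ N x
  arc⁺ {x} = ∈⟪⟫⁺ (arc? x)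

  arc⁻ : y ∈ N x → Arc x y
  arc⁻ {x = x} = ∈⟪⟫⁻ (arc? x)

  N-asym : y ∈ N x → x ∉ N y
  N-asym xy yx = oriented (arc⁻ xy) (arc⁻ yx)

  open OrientedGraph N N-asym

  -- For `x` in `N v` these are the out-neighbours of `x` in `N⁺⁺ v`: orientedness keeps `v` itself
  -- out.
  newOut : Fin n → Fin n → Subset n
  newOut v x = N x ─ N v

  -- Hall's theorem for `newOut v` on the out-neighbours of `v`. A deficient `S` has an image
  -- smaller than itself, so replacing `S` in `N v` by its image gives a set `W` smaller than `N v`.
  strongSeymour⊎violator : ∀ v → StrongSeymour v ⊎ Violator v
  strongSeymour⊎violator v with hall (filter (_∈? N v) (allFin n)) (filter⁺ (_∈? N v) (allFin⁺ n)) (newOut v)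
  ... | inj₁ (f , f∈Γ , f-inj) = inj₁ (M , record { arcs = arcs ; disjoint = disj } ,
                                       λ {x} x∈ → f x , x∈ , refl)
    where
    M : Pred (Vertex × Vertex) 0ℓ
    M (x , y) = Arc v x × y ≡ f x
    listed : Arc v x → x ∈ₗ filter (_∈? N v) (allFin n)
    listed vx = ∈-filter⁺ (_∈? N v) (∈-allFin _) (arc⁺ vx)
    arc-f : Arc v x → Arc x (f x)
    arc-f {x} vx = arc⁻ (p─q⊆p (N x) (N v) (f∈Γ (listed vx)))
    ¬arc-f : Arc v x → ¬ Arc v (f x)
    ¬arc-f {x} vx vf = x∈p─q⇒x∉q (N x) (N v) (f∈Γ (listed vx)) (arc⁺ vf)
    arcs : ∀ {x y} → M (x , y) → N⁺ v x × N⁺⁺ v y × Arc x y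
    arcs {x} (vx , refl) = vx , (outside-N , x , vx , arc-f vx) , arc-f vx
      where
      outside-N : ¬ (Arc v (f x) ⊎ v ≡ f x)
      outside-N (inj₁ vf)   = ¬arc-f vx vf
      outside-N (inj₂ v≡fx) = oriented vx (subst (Arc x) (sym v≡fx) (arc-f vx))
    disj : ∀ {x y x′ y′} → M (x , y) → M (x′ , y′) → (x , y) ≢ (x′ , y′) →
           x ≢ x′ × x ≢ y′ × y ≢ x′ × y ≢ y′
    disj (vx , refl) (vx′ , refl) ≢ =
      (λ where refl → ≢ refl) ,
      (λ eq → ¬arc-f vx′ (subst (Arc v) eq vx)) ,
      (λ eq → ¬arc-f vx (subst (Arc v) (sym eq) vx′)) ,
      (λ eq → ≢ (cong (λ x → x , f x) (f-inj (listed vx) (listed vx′) eq)))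
  ... | inj₂ (S , S⊆ , deficient) = inj₂ record
    { S = S ; W = (N v ─ S) ∪ image Γ S ; S⊆N = S⊆N
    ; disjoint = disj ; covers = covers ; closed = closed ; small = small }
    where
    Γ = newOut v
    S⊆N : S ⊆ N v
    S⊆N x∈S = proj₂ (∈-filter⁻ (_∈? N v) {xs = allFin n} (S⊆ x∈S))
    disj : x ∈ S → x ∉ (N v ─ S) ∪ image Γ S
    disj x∈S x∈ with x∈p∪q⁻ (N v ─ S) (image Γ S) x∈
    ... | inj₁ x∈N─S = x∈p─q⇒x∉q (N v) S x∈N─S x∈S
    ... | inj₂ x∈T   = let w , _ , x∈Γ = ∈-image⁻ Γ x∈T in
      x∈p─q⇒x∉q (N w) (N v) x∈Γ (S⊆N x∈S)
    covers : v ⟶ x → x ∈ S ⊎ x ∈ (N v ─ S) ∪ image Γ S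
    covers {x} vx with x ∈? S
    ... | yes x∈S = inj₁ x∈S
    ... | no x∉S  = inj₂ (x∈p∪q⁺ (inj₁ (x∈p∧x∉q⇒x∈p─q vx x∉S)))
    closed : x ∈ S → x ⟶ y → y ∈ S ⊎ y ∈ (N v ─ S) ∪ image Γ S
    closed {y = y} x∈S xy with y ∈? N v
    ... | yes vy = covers vy
    ... | no ¬vy = inj₂ (x∈p∪q⁺ (inj₂ (∈-image⁺ Γ x∈S (x∈p∧x∉q⇒x∈p─q xy ¬vy))))
    small : ∣ (N v ─ S) ∪ image Γ S ∣ < ∣ N v ∣
    small = begin-strict
      ∣ (N v ─ S) ∪ image Γ S ∣     ≤⟨ ∣p∪q∣≤∣p∣+∣q∣ (N v ─ S) (image Γ S) ⟩
      ∣ N v ─ S ∣ + ∣ image Γ S ∣   <⟨ +-monoʳ-< ∣ N v ─ S ∣ deficient ⟩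
      ∣ N v ─ S ∣ + ∣ S ∣
        ≤⟨ ∣p∣+∣q∣≤∣r∣ (N v ─ S) S (p─q⊆p (N v) S) S⊆N (x∈p─q⇒x∉q (N v) S) ⟩
      ∣ N v ∣                      ∎
      where open ≤-Reasoning

  -- A path p₁ … p_k in N v would give the path v p₁ … p_k and the arc from v to p_k.
  antiTransitive⇒P5free : ∀ {k v} → 1 ≤ k → k ≤ 5 → AntiTransitive k → P5free (N v)
  antiTransitive⇒P5free {suc k} {v} _ k≤5 anti {a} {b} {c} {d} {e}
    va vb vc vd ve ab bc cd de a≢d b≢e a≢e =
    anti (walk ∘ within) (inject≤-injective _ _ _ _ ∘ lookup-injective unique _ _ , arcs)
         (arc⁻ (from-v (inject≤ (fromℕ k) (≤-pred k≤5′))))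
    where
    k≤5′ : suc (suc k) ≤ 6
    k≤5′ = s≤s k≤5
    path : Vec (Fin n) 5
    path = a ∷ b ∷ c ∷ d ∷ e ∷ []
    walk : Fin 6 → Fin n
    walk = lookup (v ∷ path)
    -- Only the first `suc k` arcs of the walk v, a, b, c, d, e are used.
    within : Fin (suc (suc k)) → Fin 6
    within i = inject≤ i k≤5′
    from-v : ∀ i → lookup path i ∈ N v
    from-v = lookup⁺ {P = _∈ N v} (va ∷ vb ∷ vc ∷ vd ∷ ve ∷ [])
    step : ∀ i → walk (suc i) ∈ N (walk (inject₁ i))
    step zero = va
    step (suc zero) = ab
    step (suc (suc zero)) = bc
    step (suc (suc (suc zero))) = cd
    step (suc (suc (suc (suc zero)))) = de
    unique : VecUnique (v ∷ path)
    unique = (⟶⇒≢ va ∷ ⟶⇒≢ vb ∷ ⟶⇒≢ vc ∷ ⟶⇒≢ vd ∷ ⟶⇒≢ ve ∷ []) ∷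
             (⟶⇒≢ ab ∷ ⟶⟶⇒≢ ab bc ∷ a≢d ∷ a≢e ∷ []) ∷ (⟶⇒≢ bc ∷ ⟶⟶⇒≢ bc cd ∷ b≢e ∷ []) ∷
             (⟶⇒≢ cd ∷ ⟶⟶⇒≢ cd de ∷ []) ∷ (⟶⇒≢ de ∷ []) ∷ [] ∷ []
    arcs : ∀ i → Arc (walk (within (inject₁ i))) (walk (within (suc i)))
    arcs i = subst (λ j → Arc (walk j) (walk (within (suc i)))) (sym (inject≤-inject₁ i))
                   (arc⁻ (step (inject≤ i k≤5)))
      where
      inject≤-inject₁ : ∀ (i : Fin (suc k)) → within (inject₁ i) ≡ inject₁ (inject≤ i k≤5)
      inject≤-inject₁ i = toℕ-injective (trans (toℕ-inject≤ (inject₁ i) k≤5′)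
        (trans (toℕ-inject₁ i) (sym (trans (toℕ-inject₁ (inject≤ i k≤5)) (toℕ-inject≤ i k≤5)))))

-- Combining the cases

violators⇒¬small : ∀ {n} (D : Digraph (suc n)) (oriented : Digraph.Oriented D) →
  (∀ v → OrientedGraph.Violator (N D oriented) (N-asym D oriented) v) →
  ¬ (δ⁺ D ≤ 5 ⊎ ∃ λ k → 1 ≤ k × k ≤ 5 × Digraph.AntiTransitive D k)
violators⇒¬small D oriented violator = impossible
  where
  open Digraph D using (d⁺; arc?; AntiTransitive)
  open OrientedGraph (N D oriented) (N-asym D oriented)
  out = N D oriented

  ∣out∣≡d⁺ : ∀ v → ∣ out v ∣ ≡ d⁺ v
  ∣out∣≡d⁺ v = ∣⟪⟫∣≡count (arc? v) id

  v₀ = proj₁ (foldr₁-⊓-attained d⁺)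
  d⁺v₀≡δ⁺ = proj₁ (proj₂ (foldr₁-⊓-attained d⁺))
  d⁺v₀≤ = proj₂ (proj₂ (foldr₁-⊓-attained d⁺))

  -- With this choice of `δ`, `v₀` is minimal by `refl`.
  open MinimumDegree ∣ out v₀ ∣
    (λ v → subst₂ _≤_ (sym (∣out∣≡d⁺ v₀)) (sym (∣out∣≡d⁺ v)) (d⁺v₀≤ v)) violator

  impossible : ¬ (δ⁺ D ≤ 5 ⊎ ∃ λ k → 1 ≤ k × k ≤ 5 × AntiTransitive k)
  impossible (inj₂ (_ , 1≤k , k≤5 , anti)) =
    P5free⇒¬minimal (λ _ → antiTransitive⇒P5free D oriented 1≤k k≤5 anti) {v₀} refl
  impossible (inj₁ δ⁺≤5)
    with m≤n⇒m<n∨m≡n (subst (_≤ 5) (sym (trans (∣out∣≡d⁺ v₀) d⁺v₀≡δ⁺)) δ⁺≤5)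
  -- Out-neighbourhoods of minimal vertices have at most 4 elements, too few for a path on five.
  ... | inj₁ <5 = P5free⇒¬minimal (λ min → ∣C∣≤4⇒P5free (≤-trans (≤-reflexive min) (≤-pred <5)))
                                  {v₀} refl
  ... | inj₂ ≡5 = DegreeFive.¬minimal ≡5 {v₀} refl

theorem1p5 : ∀ (n : ℕ) (D : Digraph (suc n)) → Digraph.Oriented D →
    δ⁺ D ≤ 5 ⊎ at D ≤ 5 → ∃ (Digraph.StrongSeymour D)
theorem1p5 n D oriented small =
  [ id , (λ violator → ⊥-elim (violators⇒¬small D oriented violator (map₂ at⇒anti small))) ]′
    (∃⊎∀ (strongSeymour⊎violator D oriented))
  where
  at⇒anti : at D ≤ 5 → ∃ λ k → 1 ≤ k × k ≤ 5 × Digraph.AntiTransitive D k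
  at⇒anti at≤5 = let (1≤at , anti) , _ = at-isLeast D in at D , 1≤at , at≤5 , anti
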